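{- The graph $\mathcal{G}$ of minimal sets has finite connected components of arbitrarily large height, and it contains infinitely many isolated vertices.
   Context: $X$ is the graph with vertex set $\mathbb{Z}^2$ in which $(x,y)$ and $(x',y')$ are adjacent iff $|x-x'|+|y-y'|=1$. For $A\subset\mathbb{Z}^2$, $\partial A=\{u\in\mathbb{Z}^2\setminus A:\ u \text{ adjacent to some } v\in A\}$. A finite nonempty set $A$ is minimal if $|\partial A|\le|\partial C|$ for all $C\subset\mathbb{Z}^2$ with $|C|=|A|$. Two sets are congruent if some graph automorphism of $X$ maps one onto the other. The graph $\mathcal{G}$ has as vertices the congruence classes of minimal sets; two vertices are joined by an edge if they have representatives whose symmetric difference has exactly one element. The height of a component of $\mathcal{G}$ is the maximal length of a nested sequence of minimal sets whose congruence classes lie in that component. -}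

module Defs where

open import Data.Nat using (ℕ; suc; _≤_; _<_)
open import Data.Integer as ℤ using (ℤ; ∣_∣; _-_)
import Data.Integer.Properties as ℤP
open import Data.Product using (Σ; ∃; _×_; _,_)
open import Data.Product.Properties using (≡-dec)
open import Data.List using (List; []; _∷_; length; filter; _++_; concatMap)
open import Data.List.Membership.Propositional using (_∈_; _∉_)
open import Data.List.Membership.DecPropositional (≡-dec ℤP._≟_ ℤP._≟_) using (_∈?_)
open import Data.List.Relation.Unary.Any using (Any)
import Data.List
open import Relation.Nullary using (¬_)
open import Relation.Nullary.Decidable using (¬?)
open import Relation.Binary.PropositionalEquality using (_≡_)
open import Relation.Binary.Construct.Closure.ReflexiveTransitive using (Star)
open import Function.Bundles using (_⇔_)

Point : Set
Point = ℤ × ℤ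

_≟ᴾ_ = ≡-dec ℤP._≟_ ℤP._≟_

Adj : Point → Point → Set
Adj (x , y) (x' , y') = ∣ x - x' ∣ Data.Nat.+ ∣ y - y' ∣ ≡ 1

-- Finite subsets of ℤ² are represented by lists, read up to membership
-- (duplicates and order are irrelevant).
FinSet : Set
FinSet = List Point

card : FinSet → ℕ
card A = length (Data.List.deduplicate _≟ᴾ_ A)

neighbours : Point → List Point
neighbours (x , y) =
  (x ℤ.+ ℤ.+ 1 , y) ∷ (x ℤ.- ℤ.+ 1 , y) ∷ (x , y ℤ.+ ℤ.+ 1) ∷ (x , y ℤ.- ℤ.+ 1) ∷ []

boundary : FinSet → FinSet
boundary A = filter (λ u → ¬? (u ∈? A)) (concatMap neighbours A)

∂size : FinSet → ℕ
∂size A = card (boundary A)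

Nonempty : FinSet → Set
Nonempty A = 1 ≤ card A

-- A is minimal: finite, nonempty, and |∂A| ≤ |∂C| for all C ⊂ ℤ² with |C| = |A|
-- (any such C is finite, hence represented by a list).
Minimal : FinSet → Set
Minimal A = Nonempty A × (∀ (C : FinSet) → card C ≡ card A → ∂size A ≤ ∂size C)

record Automorphism : Set where
  field
    f       : Point → Point
    g       : Point → Point
    f∘g     : ∀ p → f (g p) ≡ p
    g∘f     : ∀ p → g (f p) ≡ p
    adj-iff : ∀ p q → Adj p q ⇔ Adj (f p) (f q)

MapsOnto : Automorphism → FinSet → FinSet → Set
MapsOnto φ A B =
  (∀ a → a ∈ A → Automorphism.f φ a ∈ B) ×
  (∀ b → b ∈ B → ∃ λ a → a ∈ A × Automorphism.f φ a ≡ b)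

Congruent : FinSet → FinSet → Set
Congruent A B = ∃ λ φ → MapsOnto φ A B

symDiff : FinSet → FinSet → FinSet
symDiff A B = filter (λ x → ¬? (x ∈? B)) A ++ filter (λ x → ¬? (x ∈? A)) B

-- edge relation of 𝒢 between (classes of) minimal sets A and B:
-- there are representatives A' ≅ A, B' ≅ B with |A' Δ B'| = 1
Edge : FinSet → FinSet → Set
Edge A B = Minimal A × Minimal B ×
  ∃ λ A' → ∃ λ B' → Congruent A A' × Congruent B B' × card (symDiff A' B') ≡ 1

Connected : FinSet → FinSet → Set
Connected = Star Edge

_⊂_ : FinSet → FinSet → Set
A ⊂ B = (∀ x → x ∈ A → x ∈ B) × ∃ λ x → x ∈ B × x ∉ A

FiniteComponent : FinSet → Set
FiniteComponent A = ∃ λ (L : List FinSet) →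
  ∀ B → Connected A B → ∃ λ C → C ∈ L × Congruent B C

HeightAtLeast : ℕ → FinSet → Set
HeightAtLeast n A = ∃ λ (S : ℕ → FinSet) →
  (∀ i → i ≤ n → Minimal (S i) × Connected A (S i)) ×
  (∀ i → i < n → S i ⊂ S (suc i))

Isolated : FinSet → Set
Isolated A = Minimal A × (∀ B → ¬ Edge A B)

{-# OPTIONS --safe #-}
module Submission where

-- In the coordinates u = x + y, v = x − y every neighbour of a point has the other
-- colour (parity of u), and the neighbourhood of a one-coloured set S is S + {±1}².
-- If S has r different u-values and c different v-values, then |S| ≤ rc and
-- |S + {±1}²| ≥ |S| + r + c + 1. Applied to both colour classes of C this gives
-- |∂C| ≥ r₀ + c₀ + r₁ + c₁ + 2, and |C| > 2k² − k forces |∂C| ≥ 4k + 2.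
--
-- Let 1 ≤ t and 2t² < k, and let E consist of a (k + t) × (k − t) rectangle of each
-- colour. It has 2k² − 2t² points and |∂E| = 4k + 2, so E is minimal, and so are
-- the sets obtained from it by removing fewer than k − 2t² points in a suitable order.
-- A minimal set in the component of E cannot outgrow E: one more u- or v-value
-- costs |∂| ≥ 4k + 3, whereas k × k rectangles achieve 4k + 2 for up to 2k² points.
-- Nor can it lose k − 2t² points: all rows and columns of E would still be occupied,
-- whereas 2k² − k points can be arranged with |∂| = 4k + 1. So the component
-- consists of subsets of E. With t = 1 and k large its height is large, and with
-- k = 2t² + 1 it is the single vertex E.

open import Defs
open import Algebra.Bundles using (AbelianGroup)
import Algebra.Properties.Group as GroupProperties
open import Data.Bool using (Bool; true; false; not)
import Data.Bool.Properties as BoolP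
open import Data.Empty using (⊥-elim)
open import Data.Integer as ℤ using (ℤ; +_; -[1+_])
import Data.Integer.Properties as ℤP
import Data.Integer.Tactic.RingSolver as ℤRing
open import Data.List using (List; []; _∷_; [_]; _++_; length; map; filter; cartesianProduct; cartesianProductWith; concatMap; deduplicate; upTo)
import Data.List.Extrema as Extrema
open import Data.List.Extrema.Nat using (max; xs≤max)
import Data.List.Membership.DecPropositional as DecMem
import Data.List.Membership.DecPropositional ℤP._≟_ as ℤMem
open import Data.List.Membership.Propositional using (_∈_; _∉_; find; lose)
open import Data.List.Membership.Propositional.Properties
open import Data.List.Properties using (length-++; length-map; length-upTo)
open import Data.List.Relation.Binary.Disjoint.Propositional using (Disjoint)
import Data.List.Relation.Binary.Disjoint.Propositional.Properties as Disj
open import Data.List.Relation.Binary.Subset.Propositional using (_⊆_)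
open import Data.List.Relation.Binary.Subset.Propositional.Properties using (⊆∷∧∉⇒⊆) renaming (map⁺ to map-⊆)
open import Data.List.Relation.Unary.All as All using ([]; _∷_)
open import Data.List.Relation.Unary.AllPairs using ([]; _∷_)
open import Data.List.Relation.Unary.Any using (here; there; any?)
import Data.List.Relation.Unary.Unique.DecPropositional.Properties as DecUnq
open import Data.List.Relation.Unary.Unique.Propositional using (Unique)
import Data.List.Relation.Unary.Unique.Propositional.Properties as Unq
open import Data.Nat using (ℕ; zero; suc; _+_; _*_; _∸_; _≤_; _<_; z≤n; s≤s; s≤s⁻¹)
open import Data.Nat.Properties
import Data.Nat.Tactic.RingSolver as ℕRing
open import Data.Product using (∃; ∃₂; _×_; _,_; proj₁; proj₂)
open import Data.Sum using (_⊎_; inj₁; inj₂)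
open import Data.Unit using (tt)
import Data.Unit.Properties as ⊤P
open import Function using (_∘_; id)
open import Function.Bundles using (mk⇔; Equivalence)
open import Relation.Binary.Construct.Closure.ReflexiveTransitive using (ε; _◅_; _◅◅_)
open import Relation.Binary.Definitions using (DecidableEquality; tri<; tri≈; tri>)
open import Relation.Binary.PropositionalEquality hiding ([_])
open import Relation.Nullary using (¬_; yes; no)
open import Relation.Nullary.Decidable using (¬?)

-- Cardinalities

unique⇒length-mono : {A : Set} {xs ys : List A} → Unique xs → xs ⊆ ys → length xs ≤ length ys
unique⇒length-mono {xs = []}     _          _   = z≤n
unique⇒length-mono {xs = x ∷ xs} u@(_ ∷ u′) sub with ∈-∃++ (sub (here refl))
... | as , bs , refl = begin
  suc (length xs)                ≤⟨ s≤s (unique⇒length-mono u′ sub′) ⟩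
  suc (length (as ++ bs))        ≡⟨ cong suc (length-++ as) ⟩
  suc (length as + length bs)    ≡⟨ +-suc (length as) (length bs) ⟨
  length as + suc (length bs)    ≡⟨ length-++ as ⟨
  length (as ++ x ∷ bs)          ∎
  where
  open ≤-Reasoning
  sub′ : xs ⊆ as ++ bs
  sub′ z∈xs with ∈-++⁻ as (sub (there z∈xs))
  ... | inj₁ z∈as         = ∈-++⁺ˡ z∈as
  ... | inj₂ (there z∈bs) = ∈-++⁺ʳ as z∈bs
  ... | inj₂ (here refl)  = ⊥-elim (Unq.Unique[x∷xs]⇒x∉xs u z∈xs)

module Cardinality {A : Set} (_≟_ : DecidableEquality A) where
  open DecMem _≟_ using (_∈?_)

  -- At `_≟ᴾ_` this unfolds to `card`. The instance at ℤ counts rows and columns. At the unit type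
  -- every nonempty list has value 1.
  # : List A → ℕ
  # xs = length (deduplicate _≟_ xs)

  length≤# : ∀ {xs ys} → Unique xs → xs ⊆ ys → length xs ≤ # ys
  length≤# u sub = unique⇒length-mono u (∈-deduplicate⁺ _≟_ ∘ sub)

  #≤length : ∀ {xs ys} → xs ⊆ ys → # xs ≤ length ys
  #≤length {xs} sub =
    unique⇒length-mono (DecUnq.deduplicate-! _≟_ xs) (sub ∘ ∈-deduplicate⁻ _≟_ xs)

  #-mono : ∀ {xs ys} → xs ⊆ ys → # xs ≤ # ys
  #-mono sub = #≤length (∈-deduplicate⁺ _≟_ ∘ sub)

  #-unique : ∀ {xs} → Unique xs → # xs ≡ length xs
  #-unique {xs} u = ≤-antisym (#≤length {xs} id) (length≤# {xs} u id)

  #-++-≤ : ∀ xs ys → # (xs ++ ys) ≤ # xs + # ys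
  #-++-≤ xs ys = ≤-trans (#≤length sub) (≤-reflexive (length-++ (deduplicate _≟_ xs)))
    where
    sub : xs ++ ys ⊆ deduplicate _≟_ xs ++ deduplicate _≟_ ys
    sub z∈ with ∈-++⁻ xs z∈
    ... | inj₁ z∈xs = ∈-++⁺ˡ (∈-deduplicate⁺ _≟_ z∈xs)
    ... | inj₂ z∈ys = ∈-++⁺ʳ (deduplicate _≟_ xs) (∈-deduplicate⁺ _≟_ z∈ys)

  #-disjoint : ∀ {xs ys zs} → Disjoint xs ys → xs ⊆ zs → ys ⊆ zs → # xs + # ys ≤ # zs
  #-disjoint {xs} {ys} dis xs⊆zs ys⊆zs =
    ≤-trans (≤-reflexive (sym (length-++ (deduplicate _≟_ xs)))) (length≤# unique sub)
    where
    unique : Unique (deduplicate _≟_ xs ++ deduplicate _≟_ ys)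
    unique = Unq.++⁺ (DecUnq.deduplicate-! _≟_ xs) (DecUnq.deduplicate-! _≟_ ys)
               (Disj.deduplicate⁺ _≟_ dis)
    sub : deduplicate _≟_ xs ++ deduplicate _≟_ ys ⊆ _
    sub z∈ with ∈-++⁻ (deduplicate _≟_ xs) z∈
    ... | inj₁ z∈xs = xs⊆zs (∈-deduplicate⁻ _≟_ xs z∈xs)
    ... | inj₂ z∈ys = ys⊆zs (∈-deduplicate⁻ _≟_ ys z∈ys)

  #-∷ : ∀ {x xs ys} → x ∉ xs → x ∈ ys → xs ⊆ ys → suc (# xs) ≤ # ys
  #-∷ x∉xs x∈ys sub =
    #-disjoint {[ _ ]} (λ { (here refl , x∈xs) → x∉xs x∈xs }) (λ { (here refl) → x∈ys }) sub

  #-∷-≤ : ∀ x xs → # (x ∷ xs) ≤ suc (# xs)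
  #-∷-≤ x xs = #-++-≤ [ x ] xs

  #-∈ : ∀ {x xs} → x ∈ xs → 1 ≤ # xs
  #-∈ {x} x∈xs = length≤# {[ x ]} ([] ∷ []) (λ { (here refl) → x∈xs })

  #-difference : ∀ xs ys → # xs ≤ # (filter (λ z → ¬? (z ∈? ys)) xs) + # ys
  #-difference xs ys = ≤-trans (#-mono sub) (#-++-≤ (filter (λ z → ¬? (z ∈? ys)) xs) ys)
    where
    sub : xs ⊆ filter (λ z → ¬? (z ∈? ys)) xs ++ ys
    sub {z} z∈xs with z ∈? ys
    ... | yes z∈ys = ∈-++⁺ʳ (filter (λ z → ¬? (z ∈? ys)) xs) z∈ys
    ... | no  z∉ys = ∈-++⁺ˡ (∈-filter⁺ (λ z → ¬? (z ∈? ys)) z∈xs z∉ys)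

module _ {A B : Set} (_≟ᴬ_ : DecidableEquality A) (_≟ᴮ_ : DecidableEquality B) where
  private
    module A = Cardinality _≟ᴬ_
    module B = Cardinality _≟ᴮ_

  #-map-≤ : (f : A → B) (xs : List A) → B.# (map f xs) ≤ A.# xs
  #-map-≤ f xs = ≤-trans (B.#≤length sub) (≤-reflexive (length-map f (deduplicate _≟ᴬ_ xs)))
    where
    sub : map f xs ⊆ map f (deduplicate _≟ᴬ_ xs)
    sub z∈ with ∈-map⁻ f z∈
    ... | x , x∈xs , refl = ∈-map⁺ f (∈-deduplicate⁺ _≟ᴬ_ x∈xs)

  #-map : {f : A → B} → (∀ {x y} → f x ≡ f y → x ≡ y) →
          (xs : List A) → B.# (map f xs) ≡ A.# xs
  #-map {f} inj xs = ≤-antisym (#-map-≤ f xs)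
    (≤-trans (≤-reflexive (sym (length-map f (deduplicate _≟ᴬ_ xs))))
             (B.length≤# (Unq.map⁺ inj (DecUnq.deduplicate-! _≟ᴬ_ xs)) sub))
    where
    sub : map f (deduplicate _≟ᴬ_ xs) ⊆ map f xs
    sub z∈ with ∈-map⁻ f z∈
    ... | x , x∈ , refl = ∈-map⁺ f (∈-deduplicate⁻ _≟ᴬ_ xs x∈)

module _ {A B : Set} (_≟ᴬ_ : DecidableEquality A) (_≟ᴮ_ : DecidableEquality B) where
  private
    module A = Cardinality _≟ᴬ_
    module B = Cardinality _≟ᴮ_

  -- The points that leave S under the shift meet every fibre of π: the point of
  -- largest height in a fibre is one of them.
  #-shift : (shift : A → A) (π : A → B) (height : A → ℤ) →
            (∀ {x y} → shift x ≡ shift y → x ≡ y) →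
            (∀ x → π (shift x) ≡ π x) → (∀ x → height x ℤ.< height (shift x)) →
            (S : List A) → A.# S + B.# (map π S) ≤ A.# (S ++ map shift S)
  #-shift shift π height inj π-inv rises S = begin
    A.# S + B.# (map π S)            ≤⟨ +-monoʳ-≤ (A.# S) (B.#-mono fibres) ⟩
    A.# S + B.# (map π exits)        ≤⟨ +-monoʳ-≤ (A.# S) (#-map-≤ _≟ᴬ_ _≟ᴮ_ π exits) ⟩
    A.# S + A.# exits                ≤⟨ +-monoʳ-≤ (A.# S) (≤-reflexive (sym (#-map _≟ᴬ_ _≟ᴬ_ inj exits))) ⟩
    A.# S + A.# (map shift exits)    ≤⟨ A.#-disjoint disjoint ∈-++⁺ˡ moved⊆ ⟩
    A.# (S ++ map shift S)           ∎
    where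
    open ≤-Reasoning
    open DecMem _≟ᴬ_ using (_∈?_)
    open Extrema ℤP.≤-totalOrder using (argmax; argmax-sel; f[xs]≤f[argmax])
    exits? = λ x → ¬? (shift x ∈? S)
    exits  = filter exits? S
    disjoint : Disjoint S (map shift exits)
    disjoint (z∈S , z∈) with ∈-map⁻ shift z∈
    ... | x , x∈ , refl = proj₂ (∈-filter⁻ exits? {xs = S} x∈) z∈S
    moved⊆ : map shift exits ⊆ S ++ map shift S
    moved⊆ z∈ with ∈-map⁻ shift z∈
    ... | x , x∈ , refl = ∈-++⁺ʳ S (∈-map⁺ shift (proj₁ (∈-filter⁻ exits? {xs = S} x∈)))
    fibres : map π S ⊆ map π exits
    fibres b∈ with ∈-map⁻ π b∈
    ... | x , x∈S , refl = subst (_∈ map π exits) (proj₂ top∈fibre)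
                             (∈-map⁺ π (∈-filter⁺ exits? (proj₁ top∈fibre) leaves))
      where
      fibre? = λ y → π y ≟ᴮ π x
      fibre  = filter fibre? S
      -- The default `x` lies in its own fibre, so either outcome of `argmax-sel` is a point of `S`
      -- over `π x`.
      top    = argmax height x fibre
      top∈fibre : top ∈ S × π top ≡ π x
      top∈fibre with argmax-sel height x fibre
      ... | inj₁ top≡x = subst (_∈ S) (sym top≡x) x∈S , cong π top≡x
      ... | inj₂ top∈  = ∈-filter⁻ fibre? {xs = S} top∈
      -- Otherwise `shift top` would be a higher point of the same fibre.
      leaves : shift top ∉ S
      leaves s∈S = ℤP.<⇒≱ (rises top)
        (All.lookup (f[xs]≤f[argmax] {f = height} x fibre)
          (∈-filter⁺ fibre? s∈S (trans (π-inv top) (proj₂ top∈fibre))))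

length-cartesianProductWith : {A B C : Set} (f : A → B → C) (xs : List A) (ys : List B) →
  length (cartesianProductWith f xs ys) ≡ length xs * length ys
length-cartesianProductWith f []       ys = refl
length-cartesianProductWith f (x ∷ xs) ys = trans (length-++ (map (f x) ys))
  (cong₂ _+_ (length-map (f x) ys) (length-cartesianProductWith f xs ys))

-- The isoperimetric inequality

module ℤ+ = GroupProperties (AbelianGroup.group ℤP.+-0-abelianGroup)

open DecMem _≟ᴾ_ using (_∈?_)
open Cardinality _≟ᴾ_ hiding (#)
open Cardinality ℤP._≟_ using () renaming (# to #ℤ)
module #ℤ = Cardinality ℤP._≟_

-- Diagonal coordinates and the two colours

u v : Point → ℤ
u (x , y) = x ℤ.+ y
v (x , y) = x ℤ.- y

-- The sum of the two coordinates is 2x, which gives x; then `u` gives y.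
uv-injective : ∀ {p q} → u p ≡ u q → v p ≡ v q → p ≡ q
uv-injective {x , y} {x′ , y′} eu ev = cong₂ _,_ x≡x′
  (ℤ+.∙-cancelˡ x y y′ (trans eu (cong (ℤ._+ y′) (sym x≡x′))))
  where
  double : ∀ x y → (x ℤ.+ y) ℤ.+ (x ℤ.- y) ≡ + 2 ℤ.* x
  double = ℤRing.solve-∀
  x≡x′ : x ≡ x′
  x≡x′ = ℤP.*-cancelˡ-≡ (+ 2) x x′
    (trans (sym (double x y)) (trans (cong₂ ℤ._+_ eu ev) (double x′ y′)))

odd : ℤ → Bool
odd (+ zero)       = false
odd (+ suc n)      = not (odd (+ n))
odd -[1+ zero ]    = true
odd -[1+ suc n ]   = not (odd -[1+ n ])

odd-suc : ∀ z → odd (z ℤ.+ + 1) ≡ not (odd z)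
odd-suc (+ n)         = cong (odd ∘ +_) (+-comm n 1)
odd-suc -[1+ zero ]   = refl
odd-suc -[1+ suc n ]  = sym (BoolP.not-involutive _)

odd-pred : ∀ z → odd (z ℤ.- + 1) ≡ not (odd z)
odd-pred z = begin
  odd (z ℤ.- + 1)                  ≡⟨ BoolP.not-involutive _ ⟨
  not (not (odd (z ℤ.- + 1)))      ≡⟨ cong not (odd-suc (z ℤ.- + 1)) ⟨
  not (odd (z ℤ.- + 1 ℤ.+ + 1))    ≡⟨ cong (not ∘ odd) (cancel z) ⟩
  not (odd z)                      ∎
  where
  open ≡-Reasoning
  cancel : ∀ z → z ℤ.- + 1 ℤ.+ + 1 ≡ z
  cancel = ℤRing.solve-∀

colour : Point → Bool
colour p = odd (u p)

colour-neighbours : ∀ p {q} → q ∈ neighbours p → colour q ≡ not (colour p)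
colour-neighbours (x , y) = λ where
    (here refl)                         → trans (cong odd (right x y)) (odd-suc (x ℤ.+ y))
    (there (here refl))                 → trans (cong odd (left x y)) (odd-pred (x ℤ.+ y))
    (there (there (here refl)))         → trans (cong odd (up x y)) (odd-suc (x ℤ.+ y))
    (there (there (there (here refl)))) → trans (cong odd (down x y)) (odd-pred (x ℤ.+ y))
  where
  right : ∀ x y → (x ℤ.+ + 1) ℤ.+ y ≡ x ℤ.+ y ℤ.+ + 1
  right = ℤRing.solve-∀
  left : ∀ x y → (x ℤ.- + 1) ℤ.+ y ≡ x ℤ.+ y ℤ.- + 1
  left = ℤRing.solve-∀
  up : ∀ x y → x ℤ.+ (y ℤ.+ + 1) ≡ x ℤ.+ y ℤ.+ + 1
  up = ℤRing.solve-∀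
  down : ∀ x y → x ℤ.+ (y ℤ.- + 1) ≡ x ℤ.+ y ℤ.- + 1
  down = ℤRing.solve-∀

-- Neighbourhoods of arbitrary finite sets

neighbourhood : FinSet → FinSet
neighbourhood = concatMap neighbours

∈-neighbourhood⁺ : ∀ {p q} S → p ∈ S → q ∈ neighbours p → q ∈ neighbourhood S
∈-neighbourhood⁺ S p∈S q∈ = ∈-concatMap⁺ neighbours (lose p∈S q∈)

∈-neighbourhood⁻ : ∀ {q} S → q ∈ neighbourhood S → ∃ λ p → p ∈ S × q ∈ neighbours p
∈-neighbourhood⁻ S q∈ = find (∈-concatMap⁻ neighbours {xs = S} q∈)

-- A point is determined by its values of `u` and `v`, so `S` embeds in the product of the two sets
-- of values.
card≤u*v : ∀ S → card S ≤ #ℤ (map u S) * #ℤ (map v S)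
card≤u*v S = begin
  card S                                      ≡⟨ #-map _≟ᴾ_ _≟ᴾ_ (λ eq → uv-injective (cong proj₁ eq)
                                                                              (cong proj₂ eq)) S ⟨
  card (map (λ p → u p , v p) S)              ≤⟨ #≤length sub ⟩
  length (cartesianProduct us vs)             ≡⟨ length-cartesianProductWith _,_ us vs ⟩
  #ℤ (map u S) * #ℤ (map v S)                 ∎
  where
  open ≤-Reasoning
  us vs : List ℤ
  us = deduplicate ℤP._≟_ (map u S)
  vs = deduplicate ℤP._≟_ (map v S)
  sub : map (λ p → u p , v p) S ⊆ cartesianProduct us vs
  sub q∈ with ∈-map⁻ _ q∈
  ... | p , p∈S , refl = ∈-cartesianProduct⁺ (∈-deduplicate⁺ ℤP._≟_ (∈-map⁺ u p∈S))
                                             (∈-deduplicate⁺ ℤP._≟_ (∈-map⁺ v p∈S))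

i<i+2 : ∀ i → i ℤ.< i ℤ.+ + 2
i<i+2 i = subst (ℤ._< i ℤ.+ + 2) (ℤP.+-identityʳ i) (ℤP.+-monoʳ-< i {+ 0} {+ 2} (ℤ.+<+ (s≤s z≤n)))

-- In the coordinates u, v the neighbours of p are p + (±1, ±1), so up to a
-- translation neighbourhood S is obtained by shifting S twice by 2, once in each direction.
neighbourhood-expands : ∀ S {p} → p ∈ S →
  card S + (#ℤ (map u S) + #ℤ (map v S)) + 1 ≤ card (neighbourhood S)
neighbourhood-expands S {p} p∈S = begin
  card S + (#ℤ (map u S) + #ℤ (map v S)) + 1       ≡⟨ regroup (card S) (#ℤ (map u S)) (#ℤ (map v S)) ⟩
  card S + #ℤ (map v S) + (#ℤ (map u S) + 1)       ≤⟨ +-mono-≤ first second ⟩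
  card T + #ℤ (map u T)                            ≤⟨ third ⟩
  card (T ++ map shift₂ T)                         ≡⟨ #-map _≟ᴾ_ _≟ᴾ_ back-injective (T ++ map shift₂ T) ⟨
  card (map back (T ++ map shift₂ T))              ≤⟨ #-mono sub ⟩
  card (neighbourhood S)                           ∎
  where
  open ≤-Reasoning
  regroup : ∀ a b c → a + (b + c) + 1 ≡ a + c + (b + 1)
  regroup = ℕRing.solve-∀
  -- The two shifts produce the offsets (0, 0), (1, 1), (1, -1) and (2, 0); `back` turns them into
  -- the four unit steps.
  shift₁ shift₂ back : Point → Point
  shift₁ (x , y) = x ℤ.+ + 1 , y ℤ.+ + 1
  shift₂ (x , y) = x ℤ.+ + 1 , y ℤ.- + 1
  back   (x , y) = x ℤ.- + 1 , y
  u-shift₁ : ∀ x y → (x ℤ.+ + 1) ℤ.+ (y ℤ.+ + 1) ≡ x ℤ.+ y ℤ.+ + 2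
  u-shift₁ = ℤRing.solve-∀
  v-shift₁ : ∀ x y → (x ℤ.+ + 1) ℤ.- (y ℤ.+ + 1) ≡ x ℤ.- y
  v-shift₁ = ℤRing.solve-∀
  u-shift₂ : ∀ x y → (x ℤ.+ + 1) ℤ.+ (y ℤ.- + 1) ≡ x ℤ.+ y
  u-shift₂ = ℤRing.solve-∀
  v-shift₂ : ∀ x y → (x ℤ.+ + 1) ℤ.- (y ℤ.- + 1) ≡ x ℤ.- y ℤ.+ + 2
  v-shift₂ = ℤRing.solve-∀
  back-injective : ∀ {p q} → back p ≡ back q → p ≡ q
  back-injective eq = cong₂ _,_ (ℤ+.∙-cancelʳ _ _ _ (cong proj₁ eq)) (cong proj₂ eq)
  shift₁-injective : ∀ {p q} → shift₁ p ≡ shift₁ q → p ≡ q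
  shift₁-injective eq = cong₂ _,_ (ℤ+.∙-cancelʳ _ _ _ (cong proj₁ eq)) (ℤ+.∙-cancelʳ _ _ _ (cong proj₂ eq))
  shift₂-injective : ∀ {p q} → shift₂ p ≡ shift₂ q → p ≡ q
  shift₂-injective eq = cong₂ _,_ (ℤ+.∙-cancelʳ _ _ _ (cong proj₁ eq)) (ℤ+.∙-cancelʳ _ _ _ (cong proj₂ eq))
  T : FinSet
  T = S ++ map shift₁ S
  -- `shift₁` preserves `v`, so one point per v-value is gained. In `third`, `shift₂` preserves `u`,
  -- so one point per u-value of `T` is gained.
  first : card S + #ℤ (map v S) ≤ card T
  first = #-shift _≟ᴾ_ ℤP._≟_ shift₁ v u shift₁-injective (λ (x , y) → v-shift₁ x y)
    (λ (x , y) → subst (x ℤ.+ y ℤ.<_) (sym (u-shift₁ x y)) (i<i+2 (x ℤ.+ y))) S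
  third : card T + #ℤ (map u T) ≤ card (T ++ map shift₂ T)
  third = #-shift _≟ᴾ_ ℤP._≟_ shift₂ u v shift₂-injective (λ (x , y) → u-shift₂ x y)
    (λ (x , y) → subst (x ℤ.- y ℤ.<_) (sym (v-shift₂ x y)) (i<i+2 (x ℤ.- y))) T
  sub-u : map u S ++ map (ℤ._+ + 2) (map u S) ⊆ map u T
  sub-u z∈ with ∈-++⁻ (map u S) z∈
  ... | inj₁ z∈uS with ∈-map⁻ u z∈uS
  ...   | q , q∈S , refl = ∈-map⁺ u (∈-++⁺ˡ q∈S)
  sub-u z∈ | inj₂ z∈uS+2 with ∈-map⁻ (ℤ._+ + 2) z∈uS+2
  ... | _ , z∈uS , refl with ∈-map⁻ u z∈uS
  ...   | (x , y) , q∈S , refl =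
    subst (_∈ map u T) (u-shift₁ x y) (∈-map⁺ u (∈-++⁺ʳ S (∈-map⁺ shift₁ q∈S)))
  -- The shift argument is applied to the u-values themselves, with all of ℤ as a single fibre: the
  -- largest value plus 2 is new. This is the source of the final `+ 1` and the reason why `S` must
  -- contain a point.
  second : #ℤ (map u S) + 1 ≤ #ℤ (map u T)
  second = ≤-trans (+-monoʳ-≤ (#ℤ (map u S))
                     (Cardinality.#-∈ ⊤P._≟_ (∈-map⁺ (λ _ → tt) (∈-map⁺ u p∈S))))
    (≤-trans (#-shift ℤP._≟_ ⊤P._≟_ (ℤ._+ + 2) (λ _ → tt) id (ℤ+.∙-cancelʳ _ _ _) (λ _ → refl) i<i+2 (map u S))
             (#ℤ.#-mono sub-u))
  cancel+- : ∀ x → x ℤ.+ + 1 ℤ.- + 1 ≡ x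
  cancel+- = ℤRing.solve-∀
  cancel++- : ∀ x → x ℤ.+ + 1 ℤ.+ + 1 ℤ.- + 1 ≡ x ℤ.+ + 1
  cancel++- = ℤRing.solve-∀
  sub : map back (T ++ map shift₂ T) ⊆ neighbourhood S
  sub z∈ with ∈-map⁻ back z∈
  ... | w , w∈ , refl with ∈-++⁻ T w∈
  ...   | inj₁ w∈T with ∈-++⁻ S w∈T
  ...     | inj₁ w∈S = ∈-neighbourhood⁺ S w∈S (there (here refl))
  ...     | inj₂ w∈S₁ with ∈-map⁻ shift₁ w∈S₁
  ...       | (x , y) , q∈S , refl =
    ∈-neighbourhood⁺ S q∈S (there (there (here (cong (_, y ℤ.+ + 1) (cancel+- x)))))
  sub z∈ | w , w∈ , refl | inj₂ w∈T₂ with ∈-map⁻ shift₂ w∈T₂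
  ...   | w′ , w′∈T , refl with ∈-++⁻ S w′∈T
  ...     | inj₁ q∈S = let (x , y) = w′ in
    ∈-neighbourhood⁺ S q∈S (there (there (there (here (cong (_, y ℤ.- + 1) (cancel+- x))))))
  ...     | inj₂ w′∈S₁ with ∈-map⁻ shift₁ w′∈S₁
  ...       | (x , y) , q∈S , refl =
    ∈-neighbourhood⁺ S q∈S (here (cong₂ _,_ (cancel++- x) (cancel+- y)))

-- The boundary seen from each colour class

colourClass : Bool → FinSet → FinSet
colourClass c = filter (λ p → colour p BoolP.≟ c)

∈-colourClass⁻ : ∀ c C {p} → p ∈ colourClass c C → p ∈ C × colour p ≡ c
∈-colourClass⁻ c C = ∈-filter⁻ (λ p → colour p BoolP.≟ c) {xs = C}

∈-colourClass⁺ : ∀ {c C p} → p ∈ C → colour p ≡ c → p ∈ colourClass c C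
∈-colourClass⁺ = ∈-filter⁺ (λ p → colour p BoolP.≟ _)

colour-neighbourhood : ∀ c C {q} → q ∈ neighbourhood (colourClass c C) → colour q ≡ not c
colour-neighbourhood c C q∈ with ∈-neighbourhood⁻ (colourClass c C) q∈
... | p , p∈ , q∈p =
  trans (colour-neighbours p q∈p) (cong not (proj₂ (∈-colourClass⁻ c C p∈)))

-- Neighbours change colour, so this counts the boundary points of colour `not c`. Hence the two
-- values count disjoint parts of the boundary.
∂size-from : Bool → FinSet → ℕ
∂size-from c C = card (filter (λ q → ¬? (q ∈? C)) (neighbourhood (colourClass c C)))

∂size-split : ∀ C → ∂size-from false C + ∂size-from true C ≤ ∂size C
∂size-split C = #-disjoint disjoint (sub false) (sub true)
  where
  from : Bool → FinSet
  from c = filter (λ q → ¬? (q ∈? C)) (neighbourhood (colourClass c C))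
  from⁻ : ∀ c {q} → q ∈ from c → q ∈ neighbourhood (colourClass c C) × q ∉ C
  from⁻ c = ∈-filter⁻ (λ q → ¬? (q ∈? C)) {xs = neighbourhood (colourClass c C)}
  disjoint : Disjoint (from false) (from true)
  disjoint (q∈₀ , q∈₁)
    with trans (sym (colour-neighbourhood false C (proj₁ (from⁻ false q∈₀))))
               (colour-neighbourhood true C (proj₁ (from⁻ true q∈₁)))
  ... | ()
  sub : ∀ c → from c ⊆ boundary C
  sub c q∈ with from⁻ c q∈
  ... | q∈N , q∉C with ∈-neighbourhood⁻ (colourClass c C) q∈N
  ...   | p , p∈ , q∈p = ∈-filter⁺ (λ q → ¬? (q ∈? C))
    (∈-neighbourhood⁺ C (proj₁ (∈-colourClass⁻ c C p∈)) q∈p) q∉C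

#u #v : Bool → FinSet → ℕ
#u c C = #ℤ (map u (colourClass c C))
#v c C = #ℤ (map v (colourClass c C))

-- The neighbourhood of `S` has the other colour throughout, so those of its points that belong to
-- `C` lie in `S′`. Discarding them from the expanded set costs at most `card S′`.
∂size-from-≥ : ∀ c C {p} → p ∈ colourClass c C →
  card (colourClass c C) + (#u c C + #v c C) + 1 ≤ ∂size-from c C + card (colourClass (not c) C)
∂size-from-≥ c C p∈ = ≤-trans (neighbourhood-expands S p∈)
  (≤-trans (#-difference (neighbourhood S) S′) (+-monoˡ-≤ (card S′) (#-mono sub)))
  where
  S S′ : FinSet
  S  = colourClass c C
  S′ = colourClass (not c) C
  sub : filter (λ q → ¬? (q ∈? S′)) (neighbourhood S) ⊆ filter (λ q → ¬? (q ∈? C)) (neighbourhood S)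
  sub q∈ with ∈-filter⁻ (λ q → ¬? (q ∈? S′)) {xs = neighbourhood S} q∈
  ... | q∈N , q∉S′ = ∈-filter⁺ (λ q → ¬? (q ∈? C)) q∈N
    (λ q∈C → q∉S′ (∈-colourClass⁺ q∈C (colour-neighbourhood c C q∈N)))

card-split : ∀ C → card C ≤ card (colourClass false C) + card (colourClass true C)
card-split C = ≤-trans (#-mono sub) (#-++-≤ (colourClass false C) (colourClass true C))
  where
  sub : C ⊆ colourClass false C ++ colourClass true C
  sub {p} p∈C with colour p in eq
  ... | false = ∈-++⁺ˡ (∈-colourClass⁺ p∈C eq)
  ... | true  = ∈-++⁺ʳ (colourClass false C) (∈-colourClass⁺ p∈C eq)

-- Arithmetic of the isoperimetric inequality

product-bound-ordered : ∀ m e {r c} → e ≤ 1 → r ≤ c → r + c ≤ m + m + e → r * c ≤ m * (m + e)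
product-bound-ordered m e {r} {c} e≤1 r≤c h with m≤n⇒∃[o]m+o≡n r≤m
  where
  open ≤-Reasoning
  shape : ∀ m → suc (m + m + 1) ≡ suc m + suc m
  shape = ℕRing.solve-∀
  r≤m : r ≤ m
  r≤m = ≮⇒≥ λ m<r → <⇒≱ (s≤s (+-monoʳ-≤ (m + m) e≤1)) (begin
    suc (m + m + 1)    ≡⟨ shape m ⟩
    suc m + suc m      ≤⟨ +-mono-≤ m<r (≤-trans m<r r≤c) ⟩
    r + c              ≤⟨ h ⟩
    m + m + e          ∎)
-- With m = r + d the sum condition gives c ≤ r + 2d + e, and m(m + e) exceeds r(r + 2d + e) by d(d
-- + e).
... | d , refl = begin
  r * c                                ≤⟨ *-monoʳ-≤ r c≤ ⟩
  r * (r + d + d + e)                  ≤⟨ m≤m+n _ (d * (d + e)) ⟩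
  r * (r + d + d + e) + d * (d + e)    ≡⟨ expand r d e ⟩
  (r + d) * (r + d + e)                ∎
  where
  open ≤-Reasoning
  shape : ∀ r d e → r + d + (r + d) + e ≡ r + (r + d + d + e)
  shape = ℕRing.solve-∀
  expand : ∀ r d e → r * (r + d + d + e) + d * (d + e) ≡ (r + d) * (r + d + e)
  expand = ℕRing.solve-∀
  c≤ : c ≤ r + d + d + e
  c≤ = +-cancelˡ-≤ r _ _ (≤-trans h (≤-reflexive (shape r d e)))

product-bound : ∀ m e r c → e ≤ 1 → r + c ≤ m + m + e → r * c ≤ m * (m + e)
product-bound m e r c e≤1 h with ≤-total r c
... | inj₁ r≤c = product-bound-ordered m e e≤1 r≤c h
... | inj₂ c≤r = subst (_≤ m * (m + e)) (*-comm c r)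
                   (product-bound-ordered m e e≤1 c≤r (subst (_≤ m + m + e) (+-comm r c) h))

-- Each neighbourhood may cover the opposite colour class, but in the sum of both inequalities the
-- class sizes cancel.
cross-sum : ∀ {x y p₀ p₁ δ₀ δ₁} → x + p₀ + 1 ≤ δ₀ + y → y + p₁ + 1 ≤ δ₁ + x →
            p₀ + p₁ + 2 ≤ δ₀ + δ₁
cross-sum {x} {y} {p₀} {p₁} {δ₀} {δ₁} h₀ h₁ = +-cancelˡ-≤ (x + y) _ _ (begin
  x + y + (p₀ + p₁ + 2)            ≡⟨ lhs x y p₀ p₁ ⟩
  x + p₀ + 1 + (y + p₁ + 1)        ≤⟨ +-mono-≤ h₀ h₁ ⟩
  δ₀ + y + (δ₁ + x)                ≡⟨ rhs x y δ₀ δ₁ ⟩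
  x + y + (δ₀ + δ₁)                ∎)
  where
  open ≤-Reasoning
  lhs : ∀ x y p₀ p₁ → x + y + (p₀ + p₁ + 2) ≡ x + p₀ + 1 + (y + p₁ + 1)
  lhs = ℕRing.solve-∀
  rhs : ∀ x y δ₀ δ₁ → δ₀ + y + (δ₁ + x) ≡ x + y + (δ₀ + δ₁)
  rhs = ℕRing.solve-∀

n≱1⇒n≤m : ∀ {n m} → ¬ 1 ≤ n → n ≤ m
n≱1⇒n≤m {zero}  _ = z≤n
n≱1⇒n≤m {suc n} h = ⊥-elim (h (s≤s z≤n))

-- x, y are the sizes of the two colour classes, rᵢ, cᵢ the numbers of their rows
-- and columns and δᵢ the numbers of boundary points of each colour.
size-bound : ∀ k {x y r₀ c₀ r₁ c₁ δ₀ δ₁} → 1 ≤ k → y ≤ x → x ≤ r₀ * c₀ → y ≤ r₁ * c₁ →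
  (1 ≤ x → x + (r₀ + c₀) + 1 ≤ δ₀ + y) → (1 ≤ y → y + (r₁ + c₁) + 1 ≤ δ₁ + x) →
  δ₀ + δ₁ ≤ 4 * k + 1 → x + y + k ≤ 2 * (k * k)
size-bound (suc j) {x} {y} {r₀} {c₀} {r₁} {c₁} {δ₀} {δ₁} _ y≤x x≤ y≤ h₀ h₁ hδ = cases
  where
  open ≤-Reasoning
  k p₀ p₁ : ℕ
  k  = suc j
  p₀ = r₀ + c₀
  p₁ = r₁ + c₁

  -- Since p₀ + p₁ ≤ 4k - 1, an excess q of p₀ over 2k leaves p₁ ≤ 2k - 1 - q. This needs both
  -- classes nonempty; if y = 0, the bounds on y below hold trivially.
  p₁-bound : ∀ {q} → 1 ≤ x → 1 ≤ y → 2 * k + q ≤ p₀ → p₁ + q + 1 ≤ 2 * k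
  p₁-bound {q} 1≤x 1≤y hp = +-cancelˡ-≤ (2 * k + 1) _ _ (begin
    2 * k + 1 + (p₁ + q + 1)    ≡⟨ lhs k p₁ q ⟩
    2 * k + q + p₁ + 2          ≤⟨ +-monoˡ-≤ 2 (+-monoˡ-≤ p₁ hp) ⟩
    p₀ + p₁ + 2                 ≤⟨ cross-sum {x} {y} {p₀} {p₁} {δ₀} {δ₁} (h₀ 1≤x) (h₁ 1≤y) ⟩
    δ₀ + δ₁                     ≤⟨ hδ ⟩
    4 * k + 1                   ≡⟨ rhs k ⟩
    2 * k + 1 + 2 * k           ∎)
    where
    lhs : ∀ k p q → 2 * k + 1 + (p + q + 1) ≡ 2 * k + q + p + 2
    lhs = ℕRing.solve-∀
    rhs : ∀ k → 4 * k + 1 ≡ 2 * k + 1 + 2 * k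
    rhs = ℕRing.solve-∀

  -- The larger class has at most (k - 1)k points, hence so has the smaller one, and the total is at
  -- most 2k² - 2k.
  small : p₀ < 2 * k → x + y + k ≤ 2 * (k * k)
  small p₀< = begin
    x + y + k                          ≤⟨ +-monoˡ-≤ k (+-mono-≤ x≤jk (≤-trans y≤x x≤jk)) ⟩
    j * (j + 1) + j * (j + 1) + k      ≤⟨ m≤m+n _ k ⟩
    j * (j + 1) + j * (j + 1) + k + k  ≡⟨ rhs j ⟩
    2 * (k * k)                        ∎
    where
    shape : ∀ j → 2 * suc j ≡ suc (j + j + 1)
    shape = ℕRing.solve-∀
    rhs : ∀ j → j * (j + 1) + j * (j + 1) + suc j + suc j ≡ 2 * (suc j * suc j)
    rhs = ℕRing.solve-∀
    x≤jk : x ≤ j * (j + 1)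
    x≤jk = ≤-trans x≤ (product-bound j 1 r₀ c₀ ≤-refl (s≤s⁻¹ (≤-trans p₀< (≤-reflexive (shape j)))))

  -- This is the tight case: x ≤ k² and y ≤ (k - 1)k add up to exactly 2k² - k.
  medium : 1 ≤ x → p₀ ≡ 2 * k → x + y + k ≤ 2 * (k * k)
  medium 1≤x p₀≡ = begin
    x + y + k                        ≤⟨ +-monoˡ-≤ k (+-mono-≤ x≤kk y≤jk) ⟩
    k * (k + 0) + j * (j + 1) + k    ≡⟨ rhs j ⟩
    2 * (k * k)                      ∎
    where
    rhs : ∀ j → suc j * (suc j + 0) + j * (j + 1) + suc j ≡ 2 * (suc j * suc j)
    rhs = ℕRing.solve-∀
    shape₀ : ∀ k → 2 * k ≡ k + k + 0
    shape₀ = ℕRing.solve-∀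
    shape₁ : ∀ j → 2 * suc j ≡ 1 + (j + j + 1)
    shape₁ = ℕRing.solve-∀
    shape₂ : ∀ p → p + 0 + 1 ≡ 1 + p
    shape₂ = ℕRing.solve-∀
    x≤kk : x ≤ k * (k + 0)
    x≤kk = ≤-trans x≤ (product-bound k 0 r₀ c₀ z≤n (≤-reflexive (trans p₀≡ (shape₀ k))))
    y≤jk : y ≤ j * (j + 1)
    y≤jk with 1 ≤? y
    ... | no  1≰y = n≱1⇒n≤m 1≰y
    ... | yes 1≤y = ≤-trans y≤ (product-bound j 1 r₁ c₁ ≤-refl (s≤s⁻¹ (begin
      1 + p₁               ≡⟨ shape₂ p₁ ⟨
      p₁ + 0 + 1           ≤⟨ p₁-bound 1≤x 1≤y (≤-reflexive (trans (+-identityʳ (2 * k)) (sym p₀≡))) ⟩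
      2 * k                ≡⟨ shape₁ j ⟩
      1 + (j + j + 1)      ∎)))

  -- Here x is not bounded by its rectangle but compared with y: δ₀ ≤ 4k + 1 and p₀ ≥ 2k + 1 give x
  -- ≤ y + 2k - 1, while y ≤ (k - 1)².
  large : 1 ≤ x → 2 * k < p₀ → x + y + k ≤ 2 * (k * k)
  large 1≤x <p₀ = begin
    x + y + k                            ≤⟨ +-monoˡ-≤ k (+-mono-≤ x≤y+ y≤jj) ⟩
    y + (2 * j + 1) + j * (j + 0) + k    ≤⟨ +-monoˡ-≤ k (+-monoˡ-≤ _ (+-monoˡ-≤ _ y≤jj)) ⟩
    j * (j + 0) + (2 * j + 1) + j * (j + 0) + k      ≤⟨ m≤m+n _ j ⟩
    j * (j + 0) + (2 * j + 1) + j * (j + 0) + k + j  ≡⟨ rhs j ⟩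
    2 * (k * k)                          ∎
    where
    rhs : ∀ j → j * (j + 0) + (2 * j + 1) + j * (j + 0) + suc j + j ≡ 2 * (suc j * suc j)
    rhs = ℕRing.solve-∀
    shape : ∀ j → 2 * suc j ≡ 2 + (j + j + 0)
    shape = ℕRing.solve-∀
    shape′ : ∀ p → p + 1 + 1 ≡ 2 + p
    shape′ = ℕRing.solve-∀
    lhs : ∀ x j → x + (2 * j + 4) ≡ x + suc (2 * suc j) + 1
    lhs = ℕRing.solve-∀
    4k+1 : ∀ y j → 4 * suc j + 1 + y ≡ y + (2 * j + 1) + (2 * j + 4)
    4k+1 = ℕRing.solve-∀
    y≤jj : y ≤ j * (j + 0)
    y≤jj with 1 ≤? y
    ... | no  1≰y = n≱1⇒n≤m 1≰y
    ... | yes 1≤y = ≤-trans y≤ (product-bound j 0 r₁ c₁ z≤n (s≤s⁻¹ (s≤s⁻¹ (begin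
      2 + p₁               ≡⟨ shape′ p₁ ⟨
      p₁ + 1 + 1           ≤⟨ p₁-bound 1≤x 1≤y (≤-trans (≤-reflexive (+-comm (2 * k) 1)) <p₀) ⟩
      2 * k                ≡⟨ shape j ⟩
      2 + (j + j + 0)      ∎))))
    x≤y+ : x ≤ y + (2 * j + 1)
    x≤y+ = +-cancelʳ-≤ (2 * j + 4) _ _ (begin
      x + (2 * j + 4)                  ≡⟨ lhs x j ⟩
      x + suc (2 * k) + 1              ≤⟨ +-monoˡ-≤ 1 (+-monoʳ-≤ x <p₀) ⟩
      x + p₀ + 1                       ≤⟨ h₀ 1≤x ⟩
      δ₀ + y                           ≤⟨ +-monoˡ-≤ y (≤-trans (m≤m+n δ₀ δ₁) hδ) ⟩
      4 * k + 1 + y                    ≡⟨ 4k+1 y j ⟩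
      y + (2 * j + 1) + (2 * j + 4)    ∎)

  empty : ¬ 1 ≤ x → x + y + k ≤ 2 * (k * k)
  empty 1≰x = begin
    x + y + k         ≤⟨ +-monoˡ-≤ k (+-mono-≤ (n≱1⇒n≤m {m = 0} 1≰x) (≤-trans y≤x (n≱1⇒n≤m {m = 0} 1≰x))) ⟩
    k                 ≤⟨ m≤m*n k k ⟩
    k * k             ≤⟨ m≤n*m (k * k) 2 ⟩
    2 * (k * k)       ∎

  cases : x + y + k ≤ 2 * (k * k)
  cases with 1 ≤? x | <-cmp p₀ (2 * k)
  ... | no  1≰x | _            = empty 1≰x
  ... | yes 1≤x | tri< lt _ _  = small lt
  ... | yes 1≤x | tri≈ _ eq _  = medium 1≤x eq
  ... | yes 1≤x | tri> _ _ gt  = large 1≤x gt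

∂size-≥-shape : ∀ C {p q} → p ∈ colourClass false C → q ∈ colourClass true C →
  (#u false C + #v false C) + (#u true C + #v true C) + 2 ≤ ∂size C
∂size-≥-shape C p∈ q∈ = ≤-trans
  (cross-sum {card (colourClass false C)} {card (colourClass true C)}
    (∂size-from-≥ false C p∈) (∂size-from-≥ true C q∈))
  (∂size-split C)

1≤card⇒∃ : ∀ C → 1 ≤ card C → ∃ λ p → p ∈ C
1≤card⇒∃ (p ∷ _) _ = p , here refl

-- The contrapositive of: more than 2k² - k points force at least 4k + 2 boundary points. The larger
-- colour class plays the role of x in `size-bound`.
isoperimetric : ∀ k C → 1 ≤ k → ∂size C ≤ 4 * k + 1 → card C + k ≤ 2 * (k * k)
isoperimetric k C 1≤k h = ≤-trans (+-monoˡ-≤ k (card-split C)) bound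
  where
  x y : ℕ
  x = card (colourClass false C)
  y = card (colourClass true C)
  hx : 1 ≤ x → x + (#u false C + #v false C) + 1 ≤ ∂size-from false C + y
  hx 1≤x = ∂size-from-≥ false C (proj₂ (1≤card⇒∃ _ 1≤x))
  hy : 1 ≤ y → y + (#u true C + #v true C) + 1 ≤ ∂size-from true C + x
  hy 1≤y = ∂size-from-≥ true C (proj₂ (1≤card⇒∃ _ 1≤y))
  hδ : ∂size-from false C + ∂size-from true C ≤ 4 * k + 1
  hδ = ≤-trans (∂size-split C) h
  bound : x + y + k ≤ 2 * (k * k)
  bound with ≤-total y x
  ... | inj₁ y≤x = size-bound k {r₀ = #u false C} {c₀ = #v false C} {r₁ = #u true C} 1≤k y≤x
                     (card≤u*v (colourClass false C)) (card≤u*v (colourClass true C)) hx hy hδ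
  ... | inj₂ x≤y = subst (λ s → s + k ≤ 2 * (k * k)) (+-comm y x)
                     (size-bound k {r₀ = #u true C} {c₀ = #v true C} {r₁ = #u false C} 1≤k x≤y
                       (card≤u*v (colourClass true C)) (card≤u*v (colourClass false C)) hy hx
                       (subst (_≤ 4 * k + 1) (+-comm (∂size-from false C) (∂size-from true C)) hδ))

-- Congruence and one-point extensions

∣i∣≡1 : ∀ i → ℤ.∣ i ∣ ≡ 1 → i ≡ + 1 ⊎ i ≡ -[1+ 0 ]
∣i∣≡1 (+ _)    refl = inj₁ refl
∣i∣≡1 -[1+ _ ] refl = inj₂ refl

unit-sum : ∀ m n → m + n ≡ 1 → (m ≡ 1 × n ≡ 0) ⊎ (m ≡ 0 × n ≡ 1)
unit-sum zero          n    eq   = inj₂ (refl , eq)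
unit-sum (suc zero)    zero refl = inj₁ (refl , refl)

sub-sub : ∀ i j → j ≡ i ℤ.- (i ℤ.- j)
sub-sub = ℤRing.solve-∀

Adj⇒∈neighbours : ∀ p q → Adj p q → q ∈ neighbours p
Adj⇒∈neighbours (x , y) (x′ , y′) adj
  with unit-sum ℤ.∣ x ℤ.- x′ ∣ ℤ.∣ y ℤ.- y′ ∣ adj
... | inj₁ (hx , hy) with ∣i∣≡1 (x ℤ.- x′) hx | ℤP.i-j≡0⇒i≡j y y′ (ℤP.∣i∣≡0⇒i≡0 hy)
...   | inj₁ eq | refl = there (here (cong (_, y) (trans (sub-sub x x′) (cong (ℤ._-_ x) eq))))
...   | inj₂ eq | refl = here (cong (_, y) (trans (sub-sub x x′) (cong (ℤ._-_ x) eq)))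
Adj⇒∈neighbours (x , y) (x′ , y′) adj
    | inj₂ (hx , hy) with ∣i∣≡1 (y ℤ.- y′) hy | ℤP.i-j≡0⇒i≡j x x′ (ℤP.∣i∣≡0⇒i≡0 hx)
...   | inj₁ eq | refl = there (there (there (here (cong (x ,_) (trans (sub-sub y y′) (cong (ℤ._-_ y) eq))))))
...   | inj₂ eq | refl = there (there (here (cong (x ,_) (trans (sub-sub y y′) (cong (ℤ._-_ y) eq)))))

∈neighbours⇒Adj : ∀ p q → q ∈ neighbours p → Adj p q
∈neighbours⇒Adj (x , y) _ = λ where
    (here refl)                         → cong₂ (λ a b → ℤ.∣ a ∣ + ℤ.∣ b ∣) (plus x) (ℤP.+-inverseʳ y)
    (there (here refl))                 → cong₂ (λ a b → ℤ.∣ a ∣ + ℤ.∣ b ∣) (minus x) (ℤP.+-inverseʳ y)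
    (there (there (here refl)))         → cong₂ (λ a b → ℤ.∣ a ∣ + ℤ.∣ b ∣) (ℤP.+-inverseʳ x) (plus y)
    (there (there (there (here refl)))) → cong₂ (λ a b → ℤ.∣ a ∣ + ℤ.∣ b ∣) (ℤP.+-inverseʳ x) (minus y)
  where
  plus : ∀ z → z ℤ.- (z ℤ.+ + 1) ≡ -[1+ 0 ]
  plus = ℤRing.solve-∀
  minus : ∀ z → z ℤ.- (z ℤ.- + 1) ≡ + 1
  minus = ℤRing.solve-∀

open Automorphism

identity : Automorphism
identity = record { f = id ; g = id ; f∘g = λ _ → refl ; g∘f = λ _ → refl ; adj-iff = λ _ _ → mk⇔ id id }

inverse : Automorphism → Automorphism
inverse φ = record
  { f = g φ ; g = f φ ; f∘g = g∘f φ ; g∘f = f∘g φ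
  ; adj-iff = λ p q → mk⇔
      (λ adj → Equivalence.from (adj-iff φ (g φ p) (g φ q)) (subst₂ Adj (sym (f∘g φ p)) (sym (f∘g φ q)) adj))
      (λ adj → subst₂ Adj (f∘g φ p) (f∘g φ q) (Equivalence.to (adj-iff φ (g φ p) (g φ q)) adj)) }

compose : Automorphism → Automorphism → Automorphism
compose ψ φ = record
  { f = f ψ ∘ f φ ; g = g φ ∘ g ψ
  ; f∘g = λ p → trans (cong (f ψ) (f∘g φ (g ψ p))) (f∘g ψ p)
  ; g∘f = λ p → trans (cong (g φ) (g∘f ψ (f φ p))) (g∘f φ p)
  ; adj-iff = λ p q → mk⇔
      (Equivalence.to (adj-iff ψ _ _) ∘ Equivalence.to (adj-iff φ p q))
      (Equivalence.from (adj-iff φ p q) ∘ Equivalence.from (adj-iff ψ _ _)) }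

f-injective : ∀ φ {p q} → f φ p ≡ f φ q → p ≡ q
f-injective φ {p} {q} eq = trans (sym (g∘f φ p)) (trans (cong (g φ) eq) (g∘f φ q))

mapsOnto-map : ∀ φ A → MapsOnto φ A (map (f φ) A)
mapsOnto-map φ A = (λ _ → ∈-map⁺ (f φ)) , λ b b∈ →
  let (a , a∈A , eq) = ∈-map⁻ (f φ) b∈ in a , a∈A , sym eq

mapsOnto⇒map⊆ : ∀ φ {A B} → MapsOnto φ A B → map (f φ) A ⊆ B
mapsOnto⇒map⊆ φ (into , _) b∈ with ∈-map⁻ (f φ) b∈
... | a , a∈A , refl = into a a∈A

mapsOnto⇒⊆map : ∀ φ {A B} → MapsOnto φ A B → B ⊆ map (f φ) A
mapsOnto⇒⊆map φ (_ , onto) {b} b∈ with onto b b∈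
... | a , a∈A , refl = ∈-map⁺ (f φ) a∈A

congruent-sym : ∀ {A B} → Congruent A B → Congruent B A
congruent-sym {A} {B} (φ , into , onto) = inverse φ , into′ , λ a a∈A → f φ a , into a a∈A , g∘f φ a
  where
  into′ : ∀ b → b ∈ B → g φ b ∈ A
  into′ b b∈B with onto b b∈B
  ... | a , a∈A , refl = subst (_∈ A) (sym (g∘f φ a)) a∈A

congruent-trans : ∀ {A B C} → Congruent A B → Congruent B C → Congruent A C
congruent-trans {A} {B} {C} (φ , into , onto) (ψ , into′ , onto′) =
  compose ψ φ , (λ a a∈A → into′ _ (into a a∈A)) , onto″
  where
  onto″ : ∀ c → c ∈ C → ∃ λ a → a ∈ A × f ψ (f φ a) ≡ c
  onto″ c c∈C with onto′ c c∈C
  ... | b , b∈B , refl with onto b b∈B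
  ...   | a , a∈A , refl = a , a∈A , refl

⊆⊇⇒congruent : ∀ {A B} → A ⊆ B → B ⊆ A → Congruent A B
⊆⊇⇒congruent A⊆B B⊆A = identity , (λ _ → A⊆B) , λ b b∈B → b , B⊆A b∈B , refl

congruent⇒card : ∀ {A B} → Congruent A B → card A ≡ card B
congruent⇒card {A} (φ , onto) = trans (sym (#-map _≟ᴾ_ _≟ᴾ_ (f-injective φ) A))
  (≤-antisym (#-mono (mapsOnto⇒map⊆ φ onto)) (#-mono (mapsOnto⇒⊆map φ onto)))

∈-boundary⁻ : ∀ C {q} → q ∈ boundary C → (∃ λ p → p ∈ C × q ∈ neighbours p) × q ∉ C
∈-boundary⁻ C q∈ with ∈-filter⁻ (λ q → ¬? (q ∈? C)) {xs = neighbourhood C} q∈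
... | q∈N , q∉C = ∈-neighbourhood⁻ C q∈N , q∉C

∈-boundary⁺ : ∀ C {p q} → p ∈ C → q ∈ neighbours p → q ∉ C → q ∈ boundary C
∈-boundary⁺ C p∈C q∈p = ∈-filter⁺ (λ q → ¬? (q ∈? C)) (∈-neighbourhood⁺ C p∈C q∈p)

-- A boundary point of `B` pulls back under the automorphism to a point adjacent to `A` and outside
-- it, so `boundary B` lies in the image of `boundary A`.
congruent⇒∂size-≤ : ∀ {A B} → Congruent A B → ∂size B ≤ ∂size A
congruent⇒∂size-≤ {A} {B} (φ , into , onto) =
  ≤-trans (#-mono sub) (#-map-≤ _≟ᴾ_ _≟ᴾ_ (f φ) (boundary A))
  where
  sub : boundary B ⊆ map (f φ) (boundary A)
  sub {q} q∈ with ∈-boundary⁻ B q∈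
  ... | (b , b∈B , q∈b) , q∉B with onto b b∈B
  ...   | a , a∈A , refl = subst (_∈ map (f φ) (boundary A)) (f∘g φ q)
    (∈-map⁺ (f φ) (∈-boundary⁺ A a∈A
      (Adj⇒∈neighbours a (g φ q) (Equivalence.from (adj-iff φ a (g φ q))
        (subst (Adj (f φ a)) (sym (f∘g φ q)) (∈neighbours⇒Adj (f φ a) q q∈b))))
      (λ gq∈A → q∉B (subst (_∈ B) (f∘g φ q) (into _ gq∈A)))))

congruent⇒minimal : ∀ {A B} → Congruent A B → Minimal A → Minimal B
congruent⇒minimal A≅B (nonempty , least) =
  subst (1 ≤_) eq nonempty ,
  λ C C≡B → ≤-trans (congruent⇒∂size-≤ A≅B) (least C (trans C≡B (sym eq)))
  where eq = congruent⇒card A≅B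

-- Only membership is used, since lists stand for sets up to order and repetition. Unlike a
-- symmetric difference, the record also fixes which set is the larger one.
record Extends (A : FinSet) (p : Point) (B : FinSet) : Set where
  field
    fresh : p ∉ A
    added : p ∈ B
    old   : A ⊆ B
    new   : B ⊆ p ∷ A

extends⇒card : ∀ {A p B} → Extends A p B → card B ≡ suc (card A)
extends⇒card {A} {p} e = ≤-antisym (≤-trans (#-mono new) (#-∷-≤ p A)) (#-∷ fresh added old)
  where open Extends e

extends-map : ∀ φ {A p B} → Extends A p B → Extends (map (f φ) A) (f φ p) (map (f φ) B)
extends-map φ {A} {p} e = record
  { fresh = fresh′ ; added = ∈-map⁺ (f φ) added ; old = map-⊆ (f φ) old ; new = map-⊆ (f φ) new }
  where
  open Extends e
  fresh′ : f φ p ∉ map (f φ) A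
  fresh′ fp∈ with ∈-map⁻ (f φ) fp∈
  ... | a , a∈A , eq = fresh (subst (_∈ A) (sym (f-injective φ eq)) a∈A)

card≡1⇒singleton : ∀ C → card C ≡ 1 → ∃ λ p → p ∈ C × (∀ {q} → q ∈ C → q ≡ p)
card≡1⇒singleton C eq with deduplicate _≟ᴾ_ C in dedup | eq
... | p ∷ [] | refl = p , ∈-deduplicate⁻ _≟ᴾ_ C (subst (p ∈_) (sym dedup) (here refl)) , only
  where
  only : ∀ {q} → q ∈ C → q ≡ p
  only {q} q∈C with subst (q ∈_) dedup (∈-deduplicate⁺ _≟ᴾ_ q∈C)
  ... | here q≡p = q≡p

symDiff⇒extends : ∀ A B → card (symDiff A B) ≡ 1 → ∃ λ p → Extends A p B ⊎ Extends B p A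
symDiff⇒extends A B eq with card≡1⇒singleton (symDiff A B) eq
... | p , p∈ , only = p , cases (∈-++⁻ (filter (λ x → ¬? (x ∈? B)) A) p∈)
  where
  A⊆ : A ⊆ p ∷ B
  A⊆ {a} a∈A with a ∈? B
  ... | yes a∈B = there a∈B
  ... | no  a∉B = here (only (∈-++⁺ˡ (∈-filter⁺ (λ x → ¬? (x ∈? B)) a∈A a∉B)))
  B⊆ : B ⊆ p ∷ A
  B⊆ {b} b∈B with b ∈? A
  ... | yes b∈A = there b∈A
  ... | no  b∉A = here (only (∈-++⁺ʳ (filter (λ x → ¬? (x ∈? B)) A) (∈-filter⁺ (λ x → ¬? (x ∈? A)) b∈B b∉A)))
  cases : p ∈ filter (λ x → ¬? (x ∈? B)) A ⊎ p ∈ filter (λ x → ¬? (x ∈? A)) B →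
          Extends A p B ⊎ Extends B p A
  cases (inj₁ p∈A∖B) with ∈-filter⁻ (λ x → ¬? (x ∈? B)) {xs = A} p∈A∖B
  ... | p∈A , p∉B = inj₂ record { fresh = p∉B ; added = p∈A ; old = ⊆∷∧∉⇒⊆ B⊆ p∉B ; new = A⊆ }
  cases (inj₂ p∈B∖A) with ∈-filter⁻ (λ x → ¬? (x ∈? A)) {xs = B} p∈B∖A
  ... | p∈B , p∉A = inj₁ record { fresh = p∉A ; added = p∈B ; old = ⊆∷∧∉⇒⊆ A⊆ p∉A ; new = B⊆ }

-- Pairs of rectangles

-- cell c i m is the point of colour c with (u , v) = (2i , 2m) for c = false and
-- (2i − 1 , 2m − 1) for c = true.
cell : Bool → ℕ → ℕ → Point
cell false i m = + i ℤ.+ + m , + i ℤ.- + m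
cell true  i m = + i ℤ.+ + m ℤ.- + 1 , + i ℤ.- + m

coord : Bool → ℕ → ℤ
coord false i = + 2 ℤ.* + i
coord true  i = + 2 ℤ.* + i ℤ.- + 1

coord-injective : ∀ c {i j} → coord c i ≡ coord c j → i ≡ j
coord-injective false {i} {j} eq = ℤP.+-injective (ℤP.*-cancelˡ-≡ (+ 2) (+ i) (+ j) eq)
coord-injective true  {i} {j} eq =
  ℤP.+-injective (ℤP.*-cancelˡ-≡ (+ 2) (+ i) (+ j) (ℤ+.∙-cancelʳ _ _ _ eq))

odd-double : ∀ i → odd (+ 2 ℤ.* + i) ≡ false
odd-double zero    = refl
odd-double (suc i) = trans (cong odd (double (+ i)))
  (trans (odd-suc (+ 2 ℤ.* + i ℤ.+ + 1))
    (trans (cong not (odd-suc (+ 2 ℤ.* + i))) (cong (not ∘ not) (odd-double i))))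
  where
  double : ∀ z → + 2 ℤ.* (+ 1 ℤ.+ z) ≡ + 2 ℤ.* z ℤ.+ + 1 ℤ.+ + 1
  double = ℤRing.solve-∀

odd-coord : ∀ c i → odd (coord c i) ≡ c
odd-coord false i = odd-double i
odd-coord true  i = trans (odd-pred (+ 2 ℤ.* + i)) (cong not (odd-double i))

u-cell : ∀ c i m → u (cell c i m) ≡ coord c i
u-cell false i m = sum (+ i) (+ m)
  where
  sum : ∀ a b → (a ℤ.+ b) ℤ.+ (a ℤ.- b) ≡ + 2 ℤ.* a
  sum = ℤRing.solve-∀
u-cell true i m = sum (+ i) (+ m)
  where
  sum : ∀ a b → (a ℤ.+ b ℤ.- + 1) ℤ.+ (a ℤ.- b) ≡ + 2 ℤ.* a ℤ.- + 1
  sum = ℤRing.solve-∀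

v-cell : ∀ c i m → v (cell c i m) ≡ coord c m
v-cell false i m = diff (+ i) (+ m)
  where
  diff : ∀ a b → (a ℤ.+ b) ℤ.- (a ℤ.- b) ≡ + 2 ℤ.* b
  diff = ℤRing.solve-∀
v-cell true i m = diff (+ i) (+ m)
  where
  diff : ∀ a b → (a ℤ.+ b ℤ.- + 1) ℤ.- (a ℤ.- b) ≡ + 2 ℤ.* b ℤ.- + 1
  diff = ℤRing.solve-∀

colour-cell : ∀ c i m → colour (cell c i m) ≡ c
colour-cell c i m = trans (cong odd (u-cell c i m)) (odd-coord c i)

cell-injective : ∀ c {i m i′ m′} → cell c i m ≡ cell c i′ m′ → i ≡ i′ × m ≡ m′
cell-injective c {i} {m} {i′} {m′} eq =
  coord-injective c (trans (sym (u-cell c i m)) (trans (cong u eq) (u-cell c i′ m′))) ,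
  coord-injective c (trans (sym (v-cell c i m)) (trans (cong v eq) (v-cell c i′ m′)))

-- Passing to a neighbour changes a coordinate from 2i to 2i - 1 or 2i + 1, which are the indices i
-- and i + 1 of colour true. It changes 2i + 1, the index `suc i` of colour true, to 2i or 2i + 2,
-- the indices i and i + 1 of colour false. So one relation serves both directions.
Near : ℕ → ℕ → Set
Near i i′ = i ≤ i′ × i′ ≤ suc i

same : ∀ {i} → Near i i
same = ≤-refl , n≤1+n _

next : ∀ {i} → Near i (suc i)
next = n≤1+n _ , ≤-refl

neighbours-false : ∀ i m {q} → q ∈ neighbours (cell false i m) →
  ∃₂ λ i′ m′ → Near i i′ × Near m m′ × q ≡ cell true i′ m′
neighbours-false i m = λ where
    (here refl)                         → suc i , suc m , next , next , cong₂ _,_ (right₁ (+ i) (+ m)) (right₂ (+ i) (+ m))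
    (there (here refl))                 → i , m , same , same , refl
    (there (there (here refl)))         → suc i , m , next , same , cong₂ _,_ (up₁ (+ i) (+ m)) (up₂ (+ i) (+ m))
    (there (there (there (here refl)))) → i , suc m , same , next , cong₂ _,_ (down₁ (+ i) (+ m)) (down₂ (+ i) (+ m))
  where
  right₁ : ∀ a b → a ℤ.+ b ℤ.+ + 1 ≡ (+ 1 ℤ.+ a) ℤ.+ (+ 1 ℤ.+ b) ℤ.- + 1
  right₁ = ℤRing.solve-∀
  right₂ : ∀ a b → a ℤ.- b ≡ (+ 1 ℤ.+ a) ℤ.- (+ 1 ℤ.+ b)
  right₂ = ℤRing.solve-∀
  up₁ : ∀ a b → a ℤ.+ b ≡ (+ 1 ℤ.+ a) ℤ.+ b ℤ.- + 1
  up₁ = ℤRing.solve-∀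
  up₂ : ∀ a b → a ℤ.- b ℤ.+ + 1 ≡ (+ 1 ℤ.+ a) ℤ.- b
  up₂ = ℤRing.solve-∀
  down₁ : ∀ a b → a ℤ.+ b ≡ a ℤ.+ (+ 1 ℤ.+ b) ℤ.- + 1
  down₁ = ℤRing.solve-∀
  down₂ : ∀ a b → a ℤ.- b ℤ.- + 1 ≡ a ℤ.- (+ 1 ℤ.+ b)
  down₂ = ℤRing.solve-∀

neighbours-true : ∀ i m {q} → q ∈ neighbours (cell true (suc i) (suc m)) →
  ∃₂ λ i′ m′ → Near i i′ × Near m m′ × q ≡ cell false i′ m′
neighbours-true i m = λ where
    (here refl)                         → suc i , suc m , next , next , cong₂ _,_ (right₁ (+ i) (+ m)) refl
    (there (here refl))                 → i , m , same , same , cong₂ _,_ (left₁ (+ i) (+ m)) (left₂ (+ i) (+ m))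
    (there (there (here refl)))         → suc i , m , next , same , cong₂ _,_ (up₁ (+ i) (+ m)) (up₂ (+ i) (+ m))
    (there (there (there (here refl)))) → i , suc m , same , next , cong₂ _,_ (down₁ (+ i) (+ m)) (down₂ (+ i) (+ m))
  where
  right₁ : ∀ a b → (+ 1 ℤ.+ a) ℤ.+ (+ 1 ℤ.+ b) ℤ.- + 1 ℤ.+ + 1 ≡ (+ 1 ℤ.+ a) ℤ.+ (+ 1 ℤ.+ b)
  right₁ = ℤRing.solve-∀
  left₁ : ∀ a b → (+ 1 ℤ.+ a) ℤ.+ (+ 1 ℤ.+ b) ℤ.- + 1 ℤ.- + 1 ≡ a ℤ.+ b
  left₁ = ℤRing.solve-∀
  left₂ : ∀ a b → (+ 1 ℤ.+ a) ℤ.- (+ 1 ℤ.+ b) ≡ a ℤ.- b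
  left₂ = ℤRing.solve-∀
  up₁ : ∀ a b → (+ 1 ℤ.+ a) ℤ.+ (+ 1 ℤ.+ b) ℤ.- + 1 ≡ (+ 1 ℤ.+ a) ℤ.+ b
  up₁ = ℤRing.solve-∀
  up₂ : ∀ a b → (+ 1 ℤ.+ a) ℤ.- (+ 1 ℤ.+ b) ℤ.+ + 1 ≡ (+ 1 ℤ.+ a) ℤ.- b
  up₂ = ℤRing.solve-∀
  down₁ : ∀ a b → (+ 1 ℤ.+ a) ℤ.+ (+ 1 ℤ.+ b) ℤ.- + 1 ≡ a ℤ.+ (+ 1 ℤ.+ b)
  down₁ = ℤRing.solve-∀
  down₂ : ∀ a b → (+ 1 ℤ.+ a) ℤ.- (+ 1 ℤ.+ b) ℤ.- + 1 ≡ a ℤ.- (+ 1 ℤ.+ b)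
  down₂ = ℤRing.solve-∀

range : ℕ → ℕ → List ℕ
range lo hi = map (_+_ lo) (upTo (hi ∸ lo))

∈-range⁺ : ∀ {lo hi i} → lo ≤ i → i < hi → i ∈ range lo hi
∈-range⁺ {lo} {hi} {i} lo≤i i<hi = subst (_∈ range lo hi) (m+[n∸m]≡n lo≤i)
  (∈-map⁺ (_+_ lo) (∈-upTo⁺ (∸-monoˡ-< i<hi lo≤i)))

o<n∸m⇒m+o<n : ∀ m n {o} → o < n ∸ m → m + o < n
o<n∸m⇒m+o<n zero    n       h = h
o<n∸m⇒m+o<n (suc m) (suc n) h = s≤s (o<n∸m⇒m+o<n m n h)

∈-range⁻ : ∀ {lo hi i} → i ∈ range lo hi → lo ≤ i × i < hi
∈-range⁻ {lo} {hi} i∈ with ∈-map⁻ (_+_ lo) i∈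
... | o , o∈ , refl = m≤m+n lo o , o<n∸m⇒m+o<n lo hi (∈-upTo⁻ o∈)

range-unique : ∀ lo hi → Unique (range lo hi)
range-unique lo hi = Unq.map⁺ (+-cancelˡ-≡ lo _ _) (Unq.upTo⁺ (hi ∸ lo))

length-range : ∀ lo hi → length (range lo hi) ≡ hi ∸ lo
length-range lo hi = trans (length-map (_+_ lo) (upTo (hi ∸ lo))) (length-upTo (hi ∸ lo))

block : Bool → ℕ → ℕ → ℕ → ℕ → FinSet
block c i₀ i₁ m₀ m₁ = cartesianProductWith (cell c) (range i₀ i₁) (range m₀ m₁)

∈-block⁺ : ∀ c {i₀ i₁ m₀ m₁ i m} → i₀ ≤ i → i < i₁ → m₀ ≤ m → m < m₁ →
           cell c i m ∈ block c i₀ i₁ m₀ m₁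
∈-block⁺ c h₁ h₂ h₃ h₄ = ∈-cartesianProductWith⁺ (cell c) (∈-range⁺ h₁ h₂) (∈-range⁺ h₃ h₄)

∈-block⁻ : ∀ c i₀ i₁ m₀ m₁ {q} → q ∈ block c i₀ i₁ m₀ m₁ →
           ∃₂ λ i m → q ≡ cell c i m × (i₀ ≤ i × i < i₁) × (m₀ ≤ m × m < m₁)
∈-block⁻ c i₀ i₁ m₀ m₁ q∈ with ∈-cartesianProductWith⁻ (cell c) (range i₀ i₁) (range m₀ m₁) q∈
... | i , m , i∈ , m∈ , eq = i , m , eq , ∈-range⁻ i∈ , ∈-range⁻ m∈

block-unique : ∀ c i₀ i₁ m₀ m₁ → Unique (block c i₀ i₁ m₀ m₁)
block-unique c i₀ i₁ m₀ m₁ =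
  Unq.cartesianProductWith⁺ (cell c) (cell-injective c) (range-unique i₀ i₁) (range-unique m₀ m₁)

length-block : ∀ c i₀ i₁ m₀ m₁ → length (block c i₀ i₁ m₀ m₁) ≡ (i₁ ∸ i₀) * (m₁ ∸ m₀)
length-block c i₀ i₁ m₀ m₁ = trans (length-cartesianProductWith (cell c) (range i₀ i₁) (range m₀ m₁))
  (cong₂ _*_ (length-range i₀ i₁) (length-range m₀ m₁))

-- In the (u , v)-plane: an a × b rectangle of each colour, without the first j
-- cells of the bottom row of colour false.
diamond : ℕ → ℕ → ℕ → FinSet
diamond a b j = block false 0 1 j b ++ block false 1 a 0 b ++ block true 1 (suc a) 1 (suc b)

∈-diamond-false⁺ : ∀ {a b j i m} → i < a → m < b → (i ≡ 0 → j ≤ m) → cell false i m ∈ diamond a b j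
∈-diamond-false⁺ {i = zero}  i<a m<b j≤m = ∈-++⁺ˡ (∈-block⁺ false {i₁ = 1} z≤n (s≤s z≤n) (j≤m refl) m<b)
∈-diamond-false⁺ {a} {b} {j} {suc i} i<a m<b _ = ∈-++⁺ʳ (block false 0 1 j b)
  (∈-++⁺ˡ (∈-block⁺ false (s≤s z≤n) i<a z≤n m<b))

∈-diamond-true⁺ : ∀ {a b j i m} → i < a → m < b → cell true (suc i) (suc m) ∈ diamond a b j
∈-diamond-true⁺ {a} {b} {j} i<a m<b = ∈-++⁺ʳ (block false 0 1 j b) (∈-++⁺ʳ (block false 1 a 0 b)
  (∈-block⁺ true (s≤s z≤n) (s≤s i<a) (s≤s z≤n) (s≤s m<b)))

-- A view of membership that merges the two blocks of colour false into one rectangle and indexes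
-- both colours by i < a, m < b.
data InDiamond (a b j : ℕ) : Point → Set where
  in-false : ∀ {i m} → i < a → m < b → (i ≡ 0 → j ≤ m) → InDiamond a b j (cell false i m)
  in-true  : ∀ {i m} → i < a → m < b → InDiamond a b j (cell true (suc i) (suc m))

∈-diamond⁻ : ∀ {a b j p} → 1 ≤ a → p ∈ diamond a b j → InDiamond a b j p
∈-diamond⁻ {a} {b} {j} 1≤a p∈ with ∈-++⁻ (block false 0 1 j b) p∈
... | inj₁ p∈₁ with ∈-block⁻ false 0 1 j b p∈₁
...   | i , m , refl , (_ , i<1) , (j≤m , m<b) = in-false (≤-trans i<1 1≤a) m<b (λ _ → j≤m)
∈-diamond⁻ {a} {b} {j} 1≤a p∈ | inj₂ p∈₂ with ∈-++⁻ (block false 1 a 0 b) p∈₂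
... | inj₁ p∈₃ with ∈-block⁻ false 1 a 0 b p∈₃
...   | suc i , m , refl , (_ , i<a) , (_ , m<b) = in-false i<a m<b (λ ())
∈-diamond⁻ {a} {b} {j} 1≤a p∈ | inj₂ p∈₂ | inj₂ p∈₄ with ∈-block⁻ true 1 (suc a) 1 (suc b) p∈₄
... | suc i , suc m , refl , (_ , s≤s i<a) , (_ , s≤s m<b) = in-true i<a m<b

card-diamond : ∀ {a b j} → 1 ≤ a → j ≤ b → card (diamond a b j) + j ≡ 2 * (a * b)
card-diamond {suc a} {b} {j} _ j≤b = begin
  card (diamond (suc a) b j) + j           ≡⟨ cong (_+ j) (#-unique unique) ⟩
  length (diamond (suc a) b j) + j         ≡⟨ cong (_+ j) lengths ⟩
  1 * (b ∸ j) + (a * b + suc a * b) + j    ≡⟨ regroup a b (b ∸ j) j ⟩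
  (b ∸ j + j) + (a * b + suc a * b)        ≡⟨ cong (_+ (a * b + suc a * b)) (m∸n+n≡m j≤b) ⟩
  b + (a * b + suc a * b)                  ≡⟨ total a b ⟩
  2 * (suc a * b)                          ∎
  where
  open ≡-Reasoning
  X Y Z : FinSet
  X = block false 0 1 j b
  Y = block false 1 (suc a) 0 b
  Z = block true 1 (suc (suc a)) 1 (suc b)
  regroup : ∀ a b x j → 1 * x + (a * b + suc a * b) + j ≡ (x + j) + (a * b + suc a * b)
  regroup = ℕRing.solve-∀
  total : ∀ a b → b + (a * b + suc a * b) ≡ 2 * (suc a * b)
  total = ℕRing.solve-∀
  lengths : length (diamond (suc a) b j) ≡ 1 * (b ∸ j) + (a * b + suc a * b)
  lengths = trans (length-++ X) (cong₂ _+_ (length-block false 0 1 j b)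
    (trans (length-++ Y) (cong₂ _+_ (length-block false 1 (suc a) 0 b) (length-block true 1 (suc (suc a)) 1 (suc b)))))
  X∌YZ : ∀ {p} → ¬ (p ∈ X × p ∈ Y ++ Z)
  Y∌Z : ∀ {p} → ¬ (p ∈ Y × p ∈ Z)
  X∌YZ (p∈X , p∈YZ) with ∈-block⁻ false 0 1 j b p∈X | ∈-++⁻ Y p∈YZ
  ... | i , m , refl , (_ , i<1) , _ | inj₁ p∈Y with ∈-block⁻ false 1 (suc a) 0 b p∈Y
  ...   | i′ , m′ , eq , (1≤i′ , _) , _ =
    <⇒≱ i<1 (subst (1 ≤_) (sym (proj₁ (cell-injective false eq))) 1≤i′)
  X∌YZ (p∈X , p∈YZ) | i , m , refl , _ | inj₂ p∈Z with ∈-block⁻ true 1 (suc (suc a)) 1 (suc b) p∈Z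
  ...   | i′ , m′ , eq , _ with trans (sym (colour-cell false i m)) (trans (cong colour eq) (colour-cell true i′ m′))
  ...     | ()
  Y∌Z (p∈Y , p∈Z) with ∈-block⁻ false 1 (suc a) 0 b p∈Y | ∈-block⁻ true 1 (suc (suc a)) 1 (suc b) p∈Z
  ... | i , m , refl , _ | i′ , m′ , eq , _
    with trans (sym (colour-cell false i m)) (trans (cong colour eq) (colour-cell true i′ m′))
  ...   | ()
  unique : Unique (diamond (suc a) b j)
  unique = Unq.++⁺ (block-unique false 0 1 j b)
    (Unq.++⁺ (block-unique false 1 (suc a) 0 b) (block-unique true 1 (suc (suc a)) 1 (suc b)) Y∌Z) X∌YZ

-- In order: of colour false, the row and the column just beyond the rectangle, and the `j` removed
-- cells; of colour true, the column m = 0 and the part j ≤ m < b of the row i = 0. Each removed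
-- cell thus replaces a cell of that row. The corner `cell true 0 b` is kept apart, because it is
-- adjacent to the set only while j < b.
rim : ℕ → ℕ → ℕ → FinSet
rim a b j = block false a (suc a) 0 (suc b) ++ block false 0 a b (suc b) ++ block false 0 1 0 j
         ++ block true 1 (suc a) 0 1 ++ block true 0 1 j b

boundary-diamond : ∀ {a b j q} → 1 ≤ a → q ∈ boundary (diamond a b j) →
                   (q ≡ cell true 0 b × j < b) ⊎ q ∈ rim a b j
boundary-diamond {a} {b} {j} 1≤a q∈ with ∈-boundary⁻ (diamond a b j) q∈
... | (p , p∈ , q∈p) , q∉ with ∈-diamond⁻ {a} {b} {j} 1≤a p∈
...   | in-false {i} {m} i<a m<b j≤m with neighbours-false i m q∈p
-- Row 0 of colour true is reached only from the bottom row of colour false, where just the cells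
-- with m ≥ j are present. The case m′ = b is the corner.
...     | zero , m′ , (i≤0 , _) , (m≤m′ , m′≤1+m) , refl with m≤n⇒m<n∨m≡n (≤-trans m′≤1+m m<b)
...       | inj₁ m′<b = inj₂ (∈-++⁺ʳ (block false a (suc a) 0 (suc b)) (∈-++⁺ʳ (block false 0 a b (suc b))
              (∈-++⁺ʳ (block false 0 1 0 j) (∈-++⁺ʳ (block true 1 (suc a) 0 1)
                (∈-block⁺ true {i₁ = 1} z≤n (s≤s z≤n) (≤-trans (j≤m (n≤0⇒n≡0 i≤0)) m≤m′) m′<b)))))
...       | inj₂ refl = inj₁ (refl , ≤-trans (s≤s (j≤m (n≤0⇒n≡0 i≤0))) m<b)
boundary-diamond {a} {b} {j} 1≤a q∈ | (p , p∈ , q∈p) , q∉ | in-false {i} {m} i<a m<b j≤m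
        | suc i′ , zero , (_ , s≤s i′≤i) , _ , refl =
  inj₂ (∈-++⁺ʳ (block false a (suc a) 0 (suc b)) (∈-++⁺ʳ (block false 0 a b (suc b))
    (∈-++⁺ʳ (block false 0 1 0 j) (∈-++⁺ˡ
      (∈-block⁺ true (s≤s z≤n) (s≤s (≤-trans (s≤s i′≤i) i<a)) z≤n (s≤s z≤n))))))
boundary-diamond {a} {b} {j} 1≤a q∈ | (p , p∈ , q∈p) , q∉ | in-false {i} {m} i<a m<b j≤m
        | suc i′ , suc m′ , (_ , s≤s i′≤i) , (_ , s≤s m′≤m) , refl =
  ⊥-elim (q∉ (∈-diamond-true⁺ {a} {b} {j} (≤-trans (s≤s i′≤i) i<a) (≤-trans (s≤s m′≤m) m<b)))
boundary-diamond {a} {b} {j} 1≤a q∈ | (p , p∈ , q∈p) , q∉ | in-true {i} {m} i<a m<b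
  with neighbours-true i m q∈p
... | i′ , m′ , (_ , i′≤1+i) , (_ , m′≤1+m) , refl
  with m≤n⇒m<n∨m≡n (≤-trans i′≤1+i i<a) | m≤n⇒m<n∨m≡n (≤-trans m′≤1+m m<b)
...   | inj₂ refl | _ = inj₂ (∈-++⁺ˡ (∈-block⁺ false ≤-refl ≤-refl z≤n (s≤s (≤-trans m′≤1+m m<b))))
...   | inj₁ i′<a | inj₂ refl = inj₂ (∈-++⁺ʳ (block false a (suc a) 0 (suc b))
          (∈-++⁺ˡ (∈-block⁺ false z≤n i′<a ≤-refl ≤-refl)))
-- Now `q` lies in the rectangle of colour false but not in the set, so it must be one of the
-- removed cells.
...   | inj₁ i′<a | inj₁ m′<b with i′ | j ≤? m′
...     | suc _ | _       = ⊥-elim (q∉ (∈-diamond-false⁺ {a} {b} {j} i′<a m′<b (λ ())))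
...     | zero  | yes j≤m′ = ⊥-elim (q∉ (∈-diamond-false⁺ {a} {b} {j} i′<a m′<b (λ _ → j≤m′)))
...     | zero  | no  j≰m′ = inj₂ (∈-++⁺ʳ (block false a (suc a) 0 (suc b))
            (∈-++⁺ʳ (block false 0 a b (suc b)) (∈-++⁺ˡ (∈-block⁺ false {i₁ = 1} z≤n (s≤s z≤n) z≤n (≰⇒> j≰m′)))))

length-rim : ∀ a b {j} → j ≤ b → length (rim a b j) ≡ 2 * (a + b) + 1
length-rim a b {j} j≤b = begin
  length (rim a b j)                                             ≡⟨ lengths ⟩
  (suc a ∸ a) * suc b + (a * (suc b ∸ b) + (1 * j + (a * 1 + 1 * (b ∸ j))))
    ≡⟨ cong₂ (λ x y → x * suc b + (a * y + (1 * j + (a * 1 + 1 * (b ∸ j))))) (m+n∸n≡m 1 a) (m+n∸n≡m 1 b) ⟩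
  1 * suc b + (a * 1 + (1 * j + (a * 1 + 1 * (b ∸ j))))          ≡⟨ regroup a b (b ∸ j) j ⟩
  (b ∸ j + j) + (2 * a + b + 1)                                  ≡⟨ cong (_+ (2 * a + b + 1)) (m∸n+n≡m j≤b) ⟩
  b + (2 * a + b + 1)                                            ≡⟨ total a b ⟩
  2 * (a + b) + 1                                                ∎
  where
  open ≡-Reasoning
  regroup : ∀ a b x j → 1 * suc b + (a * 1 + (1 * j + (a * 1 + 1 * x))) ≡ (x + j) + (2 * a + b + 1)
  regroup = ℕRing.solve-∀
  total : ∀ a b → b + (2 * a + b + 1) ≡ 2 * (a + b) + 1
  total = ℕRing.solve-∀
  lengths : length (rim a b j) ≡ (suc a ∸ a) * suc b + (a * (suc b ∸ b) + (1 * j + (a * 1 + 1 * (b ∸ j))))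
  lengths =
    trans (length-++ (block false a (suc a) 0 (suc b))) (cong₂ _+_ (length-block false a (suc a) 0 (suc b))
    (trans (length-++ (block false 0 a b (suc b))) (cong₂ _+_ (length-block false 0 a b (suc b))
    (trans (length-++ (block false 0 1 0 j)) (cong₂ _+_ (length-block false 0 1 0 j)
    (trans (length-++ (block true 1 (suc a) 0 1)) (cong₂ _+_ (length-block true 1 (suc a) 0 1)
      (length-block true 0 1 j b))))))))

∂size-diamond : ∀ {a b j} → 1 ≤ a → j ≤ b → ∂size (diamond a b j) ≤ 2 * (a + b) + 2
∂size-diamond {a} {b} {j} 1≤a j≤b = ≤-trans (#≤length sub)
  (≤-reflexive (trans (cong suc (length-rim a b j≤b)) (sym (+-suc (2 * (a + b)) 1))))
  where
  sub : boundary (diamond a b j) ⊆ cell true 0 b ∷ rim a b j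
  sub q∈ with boundary-diamond {a} {b} {j} 1≤a q∈
  ... | inj₁ (q≡ , _) = here q≡
  ... | inj₂ q∈rim    = there q∈rim

-- Once the whole bottom row of colour false is gone, the corner is no longer adjacent to the set.
-- For a = b = k this is the set with 2k² - k points and at most 4k + 1 boundary points.
∂size-diamond-full : ∀ {a b} → 1 ≤ a → ∂size (diamond a b b) ≤ 2 * (a + b) + 1
∂size-diamond-full {a} {b} 1≤a = ≤-trans (#≤length sub) (≤-reflexive (length-rim a b ≤-refl))
  where
  sub : boundary (diamond a b b) ⊆ rim a b b
  sub q∈ with boundary-diamond {a} {b} {b} 1≤a q∈
  ... | inj₁ (_ , b<b) = ⊥-elim (<-irrefl refl b<b)
  ... | inj₂ q∈rim     = q∈rim

-- Components of 𝒢

extends⇒symDiff : ∀ {A p B} → Extends A p B → card (symDiff B A) ≡ 1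
extends⇒symDiff {A} {p} {B} e = ≤-antisym
  (#≤length {ys = [ p ]} sub)
  (#-∈ (∈-++⁺ˡ (∈-filter⁺ (λ x → ¬? (x ∈? A)) added fresh)))
  where
  open Extends e
  sub : symDiff B A ⊆ [ p ]
  sub q∈ with ∈-++⁻ (filter (λ x → ¬? (x ∈? A)) B) q∈
  ... | inj₁ q∈B∖A with ∈-filter⁻ (λ x → ¬? (x ∈? A)) {xs = B} q∈B∖A
  ...   | q∈B , q∉A with new q∈B
  ...     | here q≡p  = here q≡p
  ...     | there q∈A = ⊥-elim (q∉A q∈A)
  sub q∈ | inj₂ q∈A∖B with ∈-filter⁻ (λ x → ¬? (x ∈? B)) {xs = A} q∈A∖B
  ...   | q∈A , q∉B = ⊥-elim (q∉B (old q∈A))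

extends⇒⊂ : ∀ {A p B} → Extends A p B → A ⊂ B
extends⇒⊂ e = (λ _ → old) , _ , added , fresh
  where open Extends e

edge⇒card≢ : ∀ {A B} → Edge A B → card A ≢ card B
edge⇒card≢ (_ , _ , A′ , B′ , A≅A′ , B≅B′ , one) eq with symDiff⇒extends A′ B′ one
... | _ , inj₁ e = 1+n≢n (trans (sym (extends⇒card e))
                     (trans (sym (congruent⇒card B≅B′)) (trans (sym eq) (congruent⇒card A≅A′))))
... | _ , inj₂ e = 1+n≢n (trans (sym (extends⇒card e))
                     (trans (sym (congruent⇒card A≅A′)) (trans eq (congruent⇒card B≅B′))))

congruent-refl : ∀ {A} → Congruent A A
congruent-refl = ⊆⊇⇒congruent id id

extends⇒edge : ∀ {A p B} → Minimal A → Minimal B → Extends A p B → Edge B A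
extends⇒edge {A} {_} {B} minA minB e =
  minB , minA , B , A , congruent-refl , congruent-refl , extends⇒symDiff e

pigeonhole : ∀ {E B R : FinSet} → Unique R → R ⊆ E → B ⊆ E → card E < card B + length R →
             ∃ λ r → r ∈ R × r ∈ B
pigeonhole {E} {B} {R} unique R⊆E B⊆E lt with any? (_∈? B) R
... | yes any = find any
... | no none = ⊥-elim (<⇒≱ lt (subst (λ n → card B + n ≤ card E) (#-unique unique)
    (#-disjoint (λ (r∈B , r∈R) → none (lose r∈R r∈B)) B⊆E R⊆E)))

diamond-extends : ∀ {a b j} → 1 ≤ a → j < b → Extends (diamond a b (suc j)) (cell false 0 j) (diamond a b j)
diamond-extends {a} {b} {j} 1≤a j<b = record
  { fresh = λ p∈ → fresh (∈-diamond⁻ {a} {b} {suc j} 1≤a p∈) refl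
  ; added = ∈-diamond-false⁺ {a} {b} {j} 1≤a j<b (λ _ → ≤-refl)
  ; old   = λ p∈ → old (∈-diamond⁻ {a} {b} {suc j} 1≤a p∈)
  ; new   = λ p∈ → new (∈-diamond⁻ {a} {b} {j} 1≤a p∈) }
  where
  fresh : ∀ {p} → InDiamond a b (suc j) p → p ≢ cell false 0 j
  fresh (in-false {i} {m} _ _ j<m) eq with cell-injective false {i} {m} {0} {j} eq
  ... | refl , refl = <-irrefl refl (j<m refl)
  fresh (in-true {i} {m} _ _) eq
    with trans (sym (colour-cell true (suc i) (suc m))) (trans (cong colour eq) (colour-cell false 0 j))
  ... | ()
  old : ∀ {p} → InDiamond a b (suc j) p → p ∈ diamond a b j
  old (in-false i<a m<b j<m) = ∈-diamond-false⁺ {a} {b} {j} i<a m<b (λ i≡0 → <⇒≤ (j<m i≡0))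
  old (in-true i<a m<b)      = ∈-diamond-true⁺ {a} {b} {j} i<a m<b
  new : ∀ {p} → InDiamond a b j p → p ∈ cell false 0 j ∷ diamond a b (suc j)
  new (in-true i<a m<b) = there (∈-diamond-true⁺ {a} {b} {suc j} i<a m<b)
  new (in-false {suc i} i<a m<b _) = there (∈-diamond-false⁺ {a} {b} {suc j} i<a m<b (λ ()))
  new (in-false {zero} {m} i<a m<b j≤m) with m≤n⇒m<n∨m≡n (j≤m refl)
  ... | inj₁ j<m  = there (∈-diamond-false⁺ {a} {b} {suc j} i<a m<b (λ _ → j<m))
  ... | inj₂ refl = here refl

sublists : {A : Set} → List A → List (List A)
sublists []       = [ [] ]
sublists (x ∷ xs) = map (x ∷_) (sublists xs) ++ sublists xs

-- Any list with members among `xs` has the same members as an entry of `sublists xs`; this yields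
-- the finite list of representatives of a component.
filter-∈? : ∀ B (xs : FinSet) → filter (_∈? B) xs ∈ sublists xs
filter-∈? B []       = here refl
filter-∈? B (x ∷ xs) with x ∈? B
... | yes _ = ∈-++⁺ˡ (∈-map⁺ (x ∷_) (filter-∈? B xs))
... | no  _ = ∈-++⁺ʳ (map (x ∷_) (sublists xs)) (filter-∈? B xs)

-- The competitor is a pair of k × k squares lacking `j` cells, which has exactly as many points as
-- `C`.
minimal⇒∂size-≤ : ∀ k j C → 1 ≤ k → j ≤ k → Minimal C → card C + j ≡ 2 * (k * k) →
                  ∂size C ≤ ∂size (diamond k k j)
minimal⇒∂size-≤ k j C 1≤k j≤k (_ , least) eq = least (diamond k k j)
  (+-cancelʳ-≡ j _ _ (trans (card-diamond 1≤k j≤k) (sym eq)))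

-- The rectangles have sides a = k + t and b = k − t; b is the parameter instead of k
-- because this avoids subtraction.
module Component (b t : ℕ) (1≤t : 1 ≤ t) (2t²<k : 2 * (t * t) < b + t) where

  a k : ℕ
  a = b + t + t
  k = b + t

  1≤k : 1 ≤ k
  1≤k = ≤-trans 1≤t (m≤n+m t b)

  1≤a : 1 ≤ a
  1≤a = ≤-trans 1≤t (m≤n+m t (b + t))

  -- As k - b = t < 2t², the number k - 2t² of points that may be missing from `full` is smaller
  -- than b, the length of a row.
  1+t≤2t² : suc t ≤ 2 * (t * t)
  1+t≤2t² = begin
    suc t              ≤⟨ +-monoˡ-≤ t 1≤t ⟩
    t + t              ≤⟨ +-mono-≤ t≤t² t≤t² ⟩
    t * t + t * t      ≡⟨ double (t * t) ⟩
    2 * (t * t)        ∎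
    where
    open ≤-Reasoning
    double : ∀ n → n + n ≡ 2 * n
    double = ℕRing.solve-∀
    t≤t² : t ≤ t * t
    t≤t² = subst (_≤ t * t) (*-identityʳ t) (*-monoʳ-≤ t 1≤t)

  j≤b : ∀ {j} → 2 * (t * t) + j < k → j ≤ b
  j≤b {j} h = <⇒≤ (+-cancelʳ-< t j b (begin-strict
    j + t                ≤⟨ +-monoʳ-≤ j (≤-trans (n≤1+n t) 1+t≤2t²) ⟩
    j + 2 * (t * t)      ≡⟨ +-comm j (2 * (t * t)) ⟩
    2 * (t * t) + j      <⟨ h ⟩
    k                    ∎))
    where open ≤-Reasoning

  2ab+2t²≡2k² : 2 * (a * b) + 2 * (t * t) ≡ 2 * (k * k)
  2ab+2t²≡2k² = expand b t
    where
    expand : ∀ b t → 2 * ((b + t + t) * b) + 2 * (t * t) ≡ 2 * ((b + t) * (b + t))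
    expand = ℕRing.solve-∀

  2[a+b]≡4k : 2 * (a + b) ≡ 4 * k
  2[a+b]≡4k = expand b t
    where
    expand : ∀ b t → 2 * (b + t + t + b) ≡ 4 * (b + t)
    expand = ℕRing.solve-∀

  full : FinSet
  full = diamond a b 0

  card-full : card full ≡ 2 * (a * b)
  card-full = trans (sym (+-identityʳ (card full))) (card-diamond {a} {b} 1≤a z≤n)

  -- The set has 2k² - 2t² - j points, so j < k - 2t² says precisely that it has more than 2k² - k
  -- points, the range where the isoperimetric inequality applies.
  diamond-large : ∀ {j} → 2 * (t * t) + j < k → 2 * (k * k) < card (diamond a b j) + k
  diamond-large {j} h = begin-strict
    2 * (k * k)                                    ≡⟨ 2ab+2t²≡2k² ⟨
    2 * (a * b) + 2 * (t * t)                      ≡⟨ cong (_+ 2 * (t * t)) (card-diamond {a} {b} 1≤a (j≤b h)) ⟨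
    card (diamond a b j) + j + 2 * (t * t)         ≡⟨ regroup (card (diamond a b j)) j (2 * (t * t)) ⟩
    card (diamond a b j) + (2 * (t * t) + j)       <⟨ +-monoʳ-< (card (diamond a b j)) h ⟩
    card (diamond a b j) + k                       ∎
    where
    open ≤-Reasoning
    regroup : ∀ x j y → x + j + y ≡ x + (y + j)
    regroup = ℕRing.solve-∀

  -- The boundary has at most 4k + 2 points; a competitor with fewer would have at most 2k² - k
  -- points by `isoperimetric`.
  diamond-minimal : ∀ {j} → 2 * (t * t) + j < k → Minimal (diamond a b j)
  diamond-minimal {j} h = nonempty , least
    where
    O : FinSet
    O = diamond a b j
    nonempty : 1 ≤ card O
    nonempty = +-cancelʳ-< k 0 (card O) (≤-<-trans k≤2k² (diamond-large h))
      where
      k≤2k² : k ≤ 2 * (k * k)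
      k≤2k² = ≤-trans (subst (_≤ k * k) (*-identityʳ k) (*-monoʳ-≤ k 1≤k)) (m≤n*m (k * k) 2)
    least : ∀ C → card C ≡ card O → ∂size O ≤ ∂size C
    least C eq = ≤-trans (∂size-diamond {a} {b} 1≤a (j≤b h)) (≮⇒≥ λ ∂C< →
      <⇒≱ (diamond-large h) (subst (λ n → n + k ≤ 2 * (k * k)) eq
        (isoperimetric k C 1≤k (s≤s⁻¹ (≤-trans ∂C<
          (≤-reflexive (trans (cong (_+ 2) 2[a+b]≡4k) (+-suc (4 * k) 1))))))))

  -- Sets occupying all rows and columns

  lo : Bool → ℕ
  lo false = 0
  lo true  = 1

  cell∈full : ∀ c {i m} → lo c ≤ i → i < lo c + a → lo c ≤ m → m < lo c + b → cell c i m ∈ full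
  cell∈full false _ i<a _ m<b = ∈-diamond-false⁺ {a} {b} {0} i<a m<b (λ _ → z≤n)
  cell∈full true (s≤s _) i<a (s≤s _) m<b = ∈-diamond-true⁺ {a} {b} {0} (s≤s⁻¹ i<a) (s≤s⁻¹ m<b)

  coords : Bool → ℕ → List ℤ
  coords c n = map (coord c) (range (lo c) (lo c + n))

  #-coords : ∀ c n → #ℤ.# (coords c n) ≡ n
  #-coords c n = trans (#ℤ.#-unique (Unq.map⁺ (coord-injective c) (range-unique (lo c) (lo c + n))))
    (trans (length-map (coord c) (range (lo c) (lo c + n)))
      (trans (length-range (lo c) (lo c + n)) (m+n∸m≡n (lo c) n)))

  coords⇒∈full : ∀ c {p} → u p ∈ coords c a → v p ∈ coords c b → p ∈ full
  coords⇒∈full c {p} u∈ v∈ with ∈-map⁻ (coord c) u∈ | ∈-map⁻ (coord c) v∈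
  ... | i , i∈ , u≡ | m , m∈ , v≡ =
    subst (_∈ full) (sym (uv-injective (trans u≡ (sym (u-cell c i m))) (trans v≡ (sym (v-cell c i m)))))
      (cell∈full c (proj₁ (∈-range⁻ i∈)) (proj₂ (∈-range⁻ i∈)) (proj₁ (∈-range⁻ m∈)) (proj₂ (∈-range⁻ m∈)))

  -- Stated as inclusions rather than counts: these persist when points are added, and a point with
  -- a value outside the list then raises the count by one.
  Spanning : FinSet → Set
  Spanning B = ∀ c → coords c a ⊆ map u (colourClass c B) × coords c b ⊆ map v (colourClass c B)

  spanning-mono : ∀ {B C} → B ⊆ C → Spanning B → Spanning C
  spanning-mono {B} {C} B⊆C span c = mono u ∘ proj₁ (span c) , mono v ∘ proj₂ (span c)
    where
    mono : (h : Point → ℤ) → map h (colourClass c B) ⊆ map h (colourClass c C)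
    mono h z∈ with ∈-map⁻ h z∈
    ... | p , p∈ , refl with ∈-colourClass⁻ c B p∈
    ...   | p∈B , eq = ∈-map⁺ h (∈-colourClass⁺ (B⊆C p∈B) eq)

  -- Fewer points of full are missing from B than any row or column contains.
  large⇒spanning : ∀ {B} → B ⊆ full → 2 * (k * k) ≤ card B + k → Spanning B
  large⇒spanning {B} B⊆full large c = rows , columns
    where
    open ≤-Reasoning
    missing : card full < card B + b
    missing = +-cancelʳ-≤ t _ _ (begin
      suc (card full) + t            ≡⟨ +-suc (card full) t ⟨
      card full + suc t              ≤⟨ +-monoʳ-≤ (card full) 1+t≤2t² ⟩
      card full + 2 * (t * t)        ≡⟨ cong (_+ 2 * (t * t)) card-full ⟩
      2 * (a * b) + 2 * (t * t)      ≡⟨ 2ab+2t²≡2k² ⟩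
      2 * (k * k)                    ≤⟨ large ⟩
      card B + (b + t)               ≡⟨ +-assoc (card B) b t ⟨
      card B + b + t                 ∎)
    b≤a : b ≤ a
    b≤a = ≤-trans (m≤m+n b t) (m≤m+n (b + t) t)
    rows : coords c a ⊆ map u (colourClass c B)
    rows z∈ with ∈-map⁻ (coord c) z∈
    ... | i , i∈ , refl with pigeonhole {R = block c i (suc i) (lo c) (lo c + b)}
            (block-unique c i (suc i) (lo c) (lo c + b)) row⊆ B⊆full
            (subst (λ n → card full < card B + n) (sym length-row) missing)
      where
      length-row : length (block c i (suc i) (lo c) (lo c + b)) ≡ b
      length-row = trans (length-block c i (suc i) (lo c) (lo c + b))
        (trans (cong₂ _*_ (m+n∸n≡m 1 i) (m+n∸m≡n (lo c) b)) (*-identityˡ b))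
      row⊆ : block c i (suc i) (lo c) (lo c + b) ⊆ full
      row⊆ r∈ with ∈-block⁻ c i (suc i) (lo c) (lo c + b) r∈
      ... | i′ , m , refl , (i≤i′ , i′≤i) , (lo≤m , m<) =
        cell∈full c (≤-trans (proj₁ (∈-range⁻ i∈)) i≤i′) (≤-<-trans (s≤s⁻¹ i′≤i) (proj₂ (∈-range⁻ i∈))) lo≤m m<
    ...   | r , r∈ , r∈B with ∈-block⁻ c i (suc i) (lo c) (lo c + b) r∈
    ...     | i′ , m , refl , (i≤i′ , i′≤i) , _ with ≤-antisym i≤i′ (s≤s⁻¹ i′≤i)
    ...       | refl = subst (_∈ map u (colourClass c B)) (u-cell c i m)
                         (∈-map⁺ u (∈-colourClass⁺ r∈B (colour-cell c i m)))
    columns : coords c b ⊆ map v (colourClass c B)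
    columns z∈ with ∈-map⁻ (coord c) z∈
    ... | m , m∈ , refl with pigeonhole {R = block c (lo c) (lo c + a) m (suc m)}
            (block-unique c (lo c) (lo c + a) m (suc m)) column⊆ B⊆full
            (subst (λ n → card full < card B + n) (sym length-column) (≤-trans missing (+-monoʳ-≤ (card B) b≤a)))
      where
      length-column : length (block c (lo c) (lo c + a) m (suc m)) ≡ a
      length-column = trans (length-block c (lo c) (lo c + a) m (suc m))
        (trans (cong₂ _*_ (m+n∸m≡n (lo c) a) (m+n∸n≡m 1 m)) (*-identityʳ a))
      column⊆ : block c (lo c) (lo c + a) m (suc m) ⊆ full
      column⊆ r∈ with ∈-block⁻ c (lo c) (lo c + a) m (suc m) r∈
      ... | i , m′ , refl , (lo≤i , i<) , (m≤m′ , m′≤m) =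
        cell∈full c lo≤i i< (≤-trans (proj₁ (∈-range⁻ m∈)) m≤m′) (≤-<-trans (s≤s⁻¹ m′≤m) (proj₂ (∈-range⁻ m∈)))
    ...   | r , r∈ , r∈B with ∈-block⁻ c (lo c) (lo c + a) m (suc m) r∈
    ...     | i , m′ , refl , _ , (m≤m′ , m′≤m) with ≤-antisym m≤m′ (s≤s⁻¹ m′≤m)
    ...       | refl = subst (_∈ map v (colourClass c B)) (v-cell c i m)
                         (∈-map⁺ v (∈-colourClass⁺ r∈B (colour-cell c i m)))

  #u-≥ : ∀ B → Spanning B → ∀ c → a ≤ #u c B
  #u-≥ B span c = ≤-trans (≤-reflexive (sym (#-coords c a))) (#ℤ.#-mono (proj₁ (span c)))

  #v-≥ : ∀ B → Spanning B → ∀ c → b ≤ #v c B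
  #v-≥ B span c = ≤-trans (≤-reflexive (sym (#-coords c b))) (#ℤ.#-mono (proj₂ (span c)))

  #u+#v-≥ : ∀ B → Spanning B → ∀ c → a + b ≤ #u c B + #v c B
  #u+#v-≥ B span c = +-mono-≤ (#u-≥ B span c) (#v-≥ B span c)

  spanning⇒class : ∀ B → Spanning B → ∀ c → ∃ λ p → p ∈ colourClass c B
  spanning⇒class B span c with ∈-map⁻ u (proj₁ (span c)
    (∈-map⁺ (coord c) (∈-range⁺ ≤-refl (m<m+n (lo c) 1≤a))))
  ... | p , p∈ , _ = p , p∈

  spanning⇒∂size : ∀ B → Spanning B → 4 * k + 2 ≤ ∂size B
  spanning⇒∂size B span = begin
    4 * k + 2                        ≡⟨ cong (_+ 2) 2[a+b]≡4k ⟨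
    2 * (a + b) + 2                  ≡⟨ cong (_+ 2) (double (a + b)) ⟩
    (a + b) + (a + b) + 2            ≤⟨ +-monoˡ-≤ 2 (+-mono-≤ (#u+#v-≥ B span false) (#u+#v-≥ B span true)) ⟩
    (#u false B + #v false B) + (#u true B + #v true B) + 2
                                     ≤⟨ ∂size-≥-shape B (proj₂ (spanning⇒class B span false))
                                                         (proj₂ (spanning⇒class B span true)) ⟩
    ∂size B                          ∎
    where
    open ≤-Reasoning
    double : ∀ n → 2 * n ≡ n + n
    double = ℕRing.solve-∀

  -- If both coordinates of `p` occurred in the rectangle of its colour, `p` would lie in `full`. So
  -- `p` adds a row or a column to those already occupied.
  outside⇒∂size : ∀ B {p} → Spanning B → p ∈ B → p ∉ full → 4 * k + 3 ≤ ∂size B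
  outside⇒∂size B {p} span p∈B p∉full = begin
    4 * k + 3                        ≡⟨ cong (_+ 3) 2[a+b]≡4k ⟨
    2 * (a + b) + 3                  ≡⟨ shape (a + b) ⟩
    suc ((a + b) + (a + b)) + 2      ≤⟨ +-monoˡ-≤ 2 (total (colour p) (longer _ refl)) ⟩
    (#u false B + #v false B) + (#u true B + #v true B) + 2
                                     ≤⟨ ∂size-≥-shape B (proj₂ (spanning⇒class B span false))
                                                         (proj₂ (spanning⇒class B span true)) ⟩
    ∂size B                          ∎
    where
    open ≤-Reasoning
    shape : ∀ n → 2 * n + 3 ≡ suc (n + n) + 2
    shape = ℕRing.solve-∀
    longer : ∀ c → colour p ≡ c → suc (a + b) ≤ #u c B + #v c B
    longer c eq with u p ℤMem.∈? (coords c a) | v p ℤMem.∈? (coords c b)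
    ... | yes u∈ | yes v∈ = ⊥-elim (p∉full (coords⇒∈full c u∈ v∈))
    ... | no  u∉ | _      = +-mono-≤
      (subst (λ n → suc n ≤ #u c B) (#-coords c a)
        (#ℤ.#-∷ u∉ (∈-map⁺ u (∈-colourClass⁺ p∈B eq)) (proj₁ (span c))))
      (#v-≥ B span c)
    ... | yes _  | no v∉  = ≤-trans (≤-reflexive (sym (+-suc a b))) (+-mono-≤ (#u-≥ B span c)
      (subst (λ n → suc n ≤ #v c B) (#-coords c b)
        (#ℤ.#-∷ v∉ (∈-map⁺ v (∈-colourClass⁺ p∈B eq)) (proj₂ (span c)))))
    total : ∀ c → suc (a + b) ≤ #u c B + #v c B →
            suc ((a + b) + (a + b)) ≤ (#u false B + #v false B) + (#u true B + #v true B)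
    total false h = +-mono-≤ h (#u+#v-≥ B span true)
    total true  h = ≤-trans (≤-reflexive (sym (+-suc (a + b) (a + b))))
      (+-mono-≤ (#u+#v-≥ B span false) h)

  -- The invariant carried along the edges of the component. It is phrased up to congruence because
  -- vertices are congruence classes.
  LargeInFull : FinSet → Set
  LargeInFull B = ∃ λ B′ → Congruent B B′ × B′ ⊆ full × 2 * (k * k) < card B′ + k

  -- Removing one point can violate the size bound only by reaching exactly 2k² - k points. Then `B`
  -- still spans and has at least 4k + 2 boundary points, whereas `diamond k k k` has the same size
  -- and at most 4k + 1.
  shrink : ∀ {A p B} → A ⊆ full → 2 * (k * k) < card A + k → Minimal B → Extends B p A →
           2 * (k * k) < card B + k
  shrink {A} {p} {B} A⊆full large minB e
    with m≤n⇒m<n∨m≡n (s≤s⁻¹ (subst (λ n → 2 * (k * k) < n + k) (extends⇒card e) large))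
  ... | inj₁ lt = lt
  ... | inj₂ eq = ⊥-elim (<⇒≱ (≤-reflexive (sym (+-suc (4 * k) 1))) (begin
    4 * k + 2                ≤⟨ spanning⇒∂size B (large⇒spanning {B} (A⊆full ∘ old) (≤-reflexive eq)) ⟩
    ∂size B                  ≤⟨ minimal⇒∂size-≤ k k B 1≤k ≤-refl minB (sym eq) ⟩
    ∂size (diamond k k k)    ≤⟨ ∂size-diamond-full {k} {k} 1≤k ⟩
    2 * (k + k) + 1          ≡⟨ shape k ⟩
    4 * k + 1                ∎))
    where
    open Extends e
    open ≤-Reasoning
    shape : ∀ k → 2 * (k + k) + 1 ≡ 4 * k + 1
    shape = ℕRing.solve-∀

  -- A new point outside `full` forces at least 4k + 3 boundary points, whereas the pair of k × k
  -- squares without `j` cells has the same size and at most 4k + 2.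
  grow : ∀ {A p B} → A ⊆ full → 2 * (k * k) < card A + k → Minimal B → Extends A p B → p ∈ full
  grow {A} {p} {B} A⊆full large minB e with p ∈? full
  ... | yes p∈full = p∈full
  ... | no  p∉full = ⊥-elim (<⇒≱ (≤-reflexive (sym (+-suc (4 * k) 2))) (begin
    4 * k + 3                ≤⟨ outside⇒∂size B spanning added p∉full ⟩
    ∂size B                  ≤⟨ minimal⇒∂size-≤ k j B 1≤k j≤k minB (m+[n∸m]≡n B≤2k²) ⟩
    ∂size (diamond k k j)    ≤⟨ ∂size-diamond {k} {k} 1≤k j≤k ⟩
    2 * (k + k) + 2          ≡⟨ shape k ⟩
    4 * k + 2                ∎))
    where
    open Extends e
    open ≤-Reasoning
    shape : ∀ k → 2 * (k + k) + 2 ≡ 4 * k + 2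
    shape = ℕRing.solve-∀
    spanning : Spanning B
    spanning = spanning-mono {A} {B} old (large⇒spanning {A} A⊆full (<⇒≤ large))
    j : ℕ
    j = 2 * (k * k) ∸ card B
    -- This makes the truncated subtraction in `j` exact: `full` has 2k² - 2t² points, so t ≥ 1
    -- leaves room for one more.
    B≤2k² : card B ≤ 2 * (k * k)
    B≤2k² = begin
      card B                         ≡⟨ extends⇒card e ⟩
      suc (card A)                   ≤⟨ s≤s (#-mono A⊆full) ⟩
      suc (card full)                ≡⟨ +-comm (card full) 1 ⟨
      card full + 1                  ≤⟨ +-monoʳ-≤ (card full) (≤-trans (s≤s z≤n) 1+t≤2t²) ⟩
      card full + 2 * (t * t)        ≡⟨ cong (_+ 2 * (t * t)) card-full ⟩
      2 * (a * b) + 2 * (t * t)      ≡⟨ 2ab+2t²≡2k² ⟩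
      2 * (k * k)                    ∎
    j≤k : j ≤ k
    j≤k = m≤n+o⇒m∸n≤o (2 * (k * k)) (card B) (≤-trans (<⇒≤ large)
            (+-monoˡ-≤ k (≤-trans (n≤1+n (card A)) (≤-reflexive (sym (extends⇒card e))))))

  -- The edge comes with its own representatives `A′` and `B′`. The automorphism `ψ` that carries
  -- `A′` onto `A″` is applied to both, so that `ψB′` differs by one point from a large subset of
  -- `full`.
  edge-preserves : ∀ {A B} → Edge A B → LargeInFull A → LargeInFull B
  edge-preserves {A} {B} (_ , minB , A′ , B′ , A≅A′ , B≅B′ , one) (A″ , A≅A″ , A″⊆full , large)
    with congruent-trans (congruent-sym A≅A′) A≅A″ | symDiff⇒extends A′ B′ one
  ... | A′≅A″@(ψ , onto) | p , e = ψB′ , B≅ψB′ , cases e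
    where
    ψA′ ψB′ : FinSet
    ψA′ = map (f ψ) A′
    ψB′ = map (f ψ) B′
    B≅ψB′ : Congruent B ψB′
    B≅ψB′ = congruent-trans B≅B′ (ψ , mapsOnto-map ψ B′)
    min : Minimal ψB′
    min = congruent⇒minimal B≅ψB′ minB
    ψA′⊆full : ψA′ ⊆ full
    ψA′⊆full = A″⊆full ∘ mapsOnto⇒map⊆ ψ onto
    large′ : 2 * (k * k) < card ψA′ + k
    large′ = subst (λ n → 2 * (k * k) < n + k)
      (trans (sym (congruent⇒card A′≅A″)) (congruent⇒card {A′} (ψ , mapsOnto-map ψ A′))) large
    cases : Extends A′ p B′ ⊎ Extends B′ p A′ → ψB′ ⊆ full × 2 * (k * k) < card ψB′ + k
    cases (inj₁ e) = sub , ≤-trans large′ (+-monoˡ-≤ k (#-mono old))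
      where
      open Extends (extends-map ψ e)
      sub : ψB′ ⊆ full
      sub q∈ with new q∈
      ... | here refl = grow ψA′⊆full large′ min (extends-map ψ e)
      ... | there q∈A = ψA′⊆full q∈A
    cases (inj₂ e) = ψA′⊆full ∘ Extends.old (extends-map ψ e) ,
                     shrink ψA′⊆full large′ min (extends-map ψ e)

  -- Finiteness, height and isolation

  full-large : LargeInFull full
  full-large = full , congruent-refl , id , diamond-large (subst (_< k) (sym (+-identityʳ (2 * (t * t)))) 2t²<k)

  full-minimal : Minimal full
  full-minimal = diamond-minimal (subst (_< k) (sym (+-identityʳ (2 * (t * t)))) 2t²<k)

  connected-preserves : ∀ {A B} → Connected A B → LargeInFull A → LargeInFull B
  connected-preserves ε        = id
  connected-preserves (e ◅ es) = connected-preserves es ∘ edge-preserves e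

  finite-component : FiniteComponent full
  finite-component = sublists full , member
    where
    member : ∀ B → Connected full B → ∃ λ C → C ∈ sublists full × Congruent B C
    member B conn with connected-preserves conn full-large
    ... | B′ , B≅B′ , B′⊆full , _ = filter (_∈? B′) full , filter-∈? B′ full ,
      congruent-trans B≅B′ (⊆⊇⇒congruent (λ q∈ → ∈-filter⁺ (_∈? B′) (B′⊆full q∈) q∈)
                                         (λ q∈ → proj₂ (∈-filter⁻ (_∈? B′) {xs = full} q∈)))

  connected-diamond : ∀ j → 2 * (t * t) + j < k → Connected full (diamond a b j)
  connected-diamond zero    _ = ε
  connected-diamond (suc j) h = connected-diamond j h′ ◅◅
    (extends⇒edge (diamond-minimal h) (diamond-minimal h′) (diamond-extends {a} {b} 1≤a (j≤b h)) ◅ ε)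
    where
    h′ : 2 * (t * t) + j < k
    h′ = ≤-<-trans (+-monoʳ-≤ (2 * (t * t)) (n≤1+n j)) h

  height : ∀ n → 2 * (t * t) + n < k → HeightAtLeast n full
  -- Removed cells are put back one at a time; at i = n the sequence reaches `full`.
  height n h = (λ i → diamond a b (n ∸ i)) ,
    (λ i _ → diamond-minimal (below i) , connected-diamond (n ∸ i) (below i)) , strict
    where
    below : ∀ i → 2 * (t * t) + (n ∸ i) < k
    below i = ≤-<-trans (+-monoʳ-≤ (2 * (t * t)) (m∸n≤m n i)) h
    step : ∀ {i n} → i < n → n ∸ i ≡ suc (n ∸ suc i)
    step {zero}  (s≤s _)   = refl
    step {suc i} (s≤s i<n) = step i<n
    strict : ∀ i → i < n → diamond a b (n ∸ i) ⊂ diamond a b (n ∸ suc i)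
    strict i i<n = subst (λ j → diamond a b j ⊂ diamond a b (n ∸ suc i)) (sym (step i<n))
      (extends⇒⊂ (diamond-extends {a} {b} 1≤a (≤-trans (≤-reflexive (sym (step i<n))) (j≤b (below i)))))

  -- For k = 2t² + 1 the bound 2k² - k equals |`full`| - 1, so a large subset of `full` has all its
  -- points. An edge, however, changes the size by one.
  isolated : k ≡ suc (2 * (t * t)) → Isolated full
  isolated k≡ = full-minimal , λ B e → no-edge B e (edge-preserves e full-large)
    where
    no-edge : ∀ B → Edge full B → ¬ LargeInFull B
    no-edge B e (B′ , B≅B′ , B′⊆full , large) = edge⇒card≢ e (trans
      (≤-antisym (s≤s⁻¹ (+-cancelʳ-≤ (2 * (t * t)) _ _ (begin
        suc (card full) + 2 * (t * t)          ≡⟨ cong (λ n → suc n + 2 * (t * t)) card-full ⟩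
        suc (2 * (a * b) + 2 * (t * t))        ≡⟨ cong suc 2ab+2t²≡2k² ⟩
        suc (2 * (k * k))                      ≤⟨ large ⟩
        card B′ + k                            ≡⟨ cong (_+_ (card B′)) k≡ ⟩
        card B′ + suc (2 * (t * t))            ≡⟨ +-suc (card B′) (2 * (t * t)) ⟩
        suc (card B′) + 2 * (t * t)            ∎)))
        (#-mono B′⊆full))
      (sym (congruent⇒card B≅B′)))
      where open ≤-Reasoning

theorem8p11 : ((n : ℕ) → ∃ λ A → Minimal A × FiniteComponent A × HeightAtLeast n A) ×
    ((L : List FinSet) → ∃ λ A → Isolated A × (∀ B → B ∈ L → ¬ Congruent A B))
theorem8p11 = high , isolated-avoiding
  where
  high : (n : ℕ) → ∃ λ A → Minimal A × FiniteComponent A × HeightAtLeast n A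
  high n = full , full-minimal , finite-component , height n (≤-reflexive (shape n))
    where
    shape : ∀ n → suc (2 + n) ≡ 2 + n + 1
    shape = ℕRing.solve-∀
    -- With t = 1 this gives k = n + 3, the least k with 2t² + n < k.
    open Component (2 + n) 1 ≤-refl (≤-trans (s≤s (m≤m+n 2 n)) (≤-reflexive (shape n)))

  isolated-avoiding : (L : List FinSet) → ∃ λ A → Isolated A × (∀ B → B ∈ L → ¬ Congruent A B)
  isolated-avoiding L = full , isolated (sym 2t²+1≡k) , avoids
    where
    s b : ℕ
    -- Congruent sets have equal size, so it suffices that `full` is larger than every listed set.
    -- Taking t = s + 1 achieves this; the default 0 covers the empty list.
    s = max 0 (map card L)
    b = 2 * (s * s) + 3 * s + 2
    -- b is chosen such that k = b + t = 2t² + 1 for t = s + 1.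
    2t²+1≡k : suc (2 * (suc s * suc s)) ≡ b + suc s
    2t²+1≡k = shape s
      where
      shape : ∀ s → suc (2 * (suc s * suc s)) ≡ 2 * (s * s) + 3 * s + 2 + suc s
      shape = ℕRing.solve-∀
    open Component b (suc s) (s≤s z≤n) (≤-reflexive 2t²+1≡k)
    s<card : s < card full
    s<card = begin-strict
      s                  <⟨ m<n+m s {b + suc s} 1≤k ⟩
      b + suc s + s      ≤⟨ +-monoʳ-≤ (b + suc s) (n≤1+n s) ⟩
      a                  ≡⟨ *-identityʳ a ⟨
      a * 1              ≤⟨ *-monoʳ-≤ a (≤-trans (s≤s z≤n) (m≤n+m 2 (2 * (s * s) + 3 * s))) ⟩
      a * b              ≤⟨ m≤n*m (a * b) 2 ⟩
      2 * (a * b)        ≡⟨ card-full ⟨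
      card full          ∎
      where
      open ≤-Reasoning
    avoids : ∀ B → B ∈ L → ¬ Congruent full B
    avoids B B∈L full≅B = <⇒≱ s<card (subst (_≤ s) (sym (congruent⇒card full≅B))
      (All.lookup (xs≤max 0 (map card L)) (∈-map⁺ card B∈L)))
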